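{- Let $q$ be a prime power and $n,t,m$ positive integers with $t\geq m$. Let $\ell$ be a positive integer such that $$ e \left[ {\ell \choose t} - { \ell-t \choose t} \right] \left(\frac{m}{q}\right)^{n} \leq 1,$$ where $e$ is Euler's number and ${\ell-t \choose t}$ is set to zero if $\ell < 2t$. Then $EGZ(t,\mathbb{F}_q^{n},m) > \ell$.
   Context: $\mathbb{F}_q^n$ is viewed as a commutative ring with coordinatewise operations. For elements $g_1,\dots,g_t$ of a commutative ring $R$, $e_m(g_1,\dots,g_t)=\sum_{1\leq i_1<\cdots<i_m\leq t}\prod_{j=1}^m g_{i_j}$. A sequence over $R$ is a finite list of elements of $R$ (repetitions allowed); a subsequence of length $t$ is obtained by choosing $t$ distinct positions. For a finite commutative ring $R$, $EGZ(t,R,m)$ is the smallest positive integer $\ell$ such that every sequence $S$ over $R$ of length $|S|\geq \ell$ contains a subsequence $S'$ of length $t$ with $e_m(S')=0$ in $R$; if no such $\ell$ exists, $EGZ(t,R,m)=\infty$. -}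

module Defs where

open import Algebra.Apartness.Bundles using (HeytingField; HeytingCommutativeRing)
open import Algebra.Bundles using (CommutativeRing)
import Algebra.Construct.Pointwise as Pointwise
open import Data.Empty using (⊥-elim)
open import Data.Fin.Base using (Fin)
open import Data.Integer.Base as ℤ using (+_)
open import Data.List.Base using (List; []; _∷_; _++_; foldr; length; map)
open import Data.List.Relation.Binary.Sublist.Propositional using (_⊆_)
open import Data.Nat.Base as ℕ using (ℕ; zero; suc; _!)
open import Data.Nat.Induction using (<-rec)
open import Data.Nat.Primality using (Prime)
import Data.Nat.Properties as ℕ
open import Data.Nat.Properties using (_!≢0)
open import Data.Product.Base using (_×_; _,_; ∃; ∃₂)
open import Data.Rational.Base as ℚ using (ℚ; 0ℚ; 1ℚ; ↧ₙ_; mkℚ)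
import Data.Rational.Properties as ℚ
import Data.Rational.Unnormalised.Base as ℚᵘ
import Data.Rational.Unnormalised.Properties as ℚᵘ
import Data.Integer.Properties as ℤ
open import Data.Rational.Solver using (module +-*-Solver)
open import Data.Sum.Base using (inj₁; inj₂)
open import Function.Bundles using (Inverse)
open import Level using (Level; _⊔_) renaming (suc to lsuc)
open import Relation.Binary.PropositionalEquality
  using (_≡_; refl; sym; trans; cong; cong₂; subst; subst₂; setoid)
import Relation.Nullary.Construct.Add.Supremum as Sup
open Sup using (_⁺; ⊤⁺)
import Relation.Binary.Construct.Add.Supremum.Strict as SupStrict
open import Relation.Nullary.Negation.Core using (¬_)

open import Algebra.Definitions.RawSemiring ℚ.+-*-rawSemiring public
  using () renaming (_^_ to _^ℚ_)

-- A Cauchy real is given by any rational Cauchy sequence converging to it.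
-- Equality of reals, not needed below, would be x ≤ᵣ y together with y ≤ᵣ x.
record ℝ : Set where
  field
    seq    : ℕ → ℚ
    cauchy : ∀ ε → 0ℚ ℚ.< ε → ∃ λ N → ∀ i j → N ℕ.≤ i → N ℕ.≤ j →
             ℚ.∣ seq i ℚ.- seq j ∣ ℚ.≤ ε

open ℝ public

infix  4 _≤ᵣ_
infixl 7 _·ᵣ_

_≤ᵣ_ : ℝ → ℝ → Set
x ≤ᵣ y = ∀ ε → 0ℚ ℚ.< ε → ∃ λ N → ∀ i → N ℕ.≤ i →
         seq x i ℚ.≤ seq y i ℚ.+ ε

fromℚ : ℚ → ℝ
fromℚ r = record
  { seq    = λ _ → r
  ; cauchy = λ ε 0<ε → 0 , λ _ _ _ _ →
      subst (ℚ._≤ ε) (sym (cong ℚ.∣_∣ (ℚ.+-inverseʳ r))) (ℚ.<⇒≤ 0<ε)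
  }

_·ᵣ_ : ℝ → ℚ → ℝ
x ·ᵣ r = record
  { seq    = λ i → seq x i ℚ.* r
  ; cauchy = λ ε 0<ε →
      let N , near = cauchy x (δ ε) (0<δ ε 0<ε)
      in  N , λ i j N≤i N≤j → scaled ε 0<ε (seq x i) (seq x j) (near i j N≤i N≤j)
  }
  where
  b : ℚ
  b = ℚ.∣ r ∣ ℚ.+ 1ℚ

  instance
    b-pos : ℚ.Positive b
    b-pos = ℚ.nonNeg+pos⇒pos ℚ.∣ r ∣ {{ℚ.∣-∣-nonNeg r}} 1ℚ

    b-nonZero : ℚ.NonZero b
    b-nonZero = ℚ.pos⇒nonZero b

    1/b-pos : ℚ.Positive (ℚ.1/ b)
    1/b-pos = ℚ.1/pos⇒pos b

  δ : ℚ → ℚ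
  δ ε = ε ℚ.* ℚ.1/ b

  0<δ : ∀ ε → 0ℚ ℚ.< ε → 0ℚ ℚ.< δ ε
  0<δ ε 0<ε = subst (ℚ._< δ ε) (ℚ.*-zeroˡ (ℚ.1/ b)) (ℚ.*-monoˡ-<-pos (ℚ.1/ b) 0<ε)

  ∣r∣≤b : ℚ.∣ r ∣ ℚ.≤ b
  ∣r∣≤b = subst (ℚ._≤ b) (ℚ.+-identityʳ ℚ.∣ r ∣)
            (ℚ.+-monoʳ-≤ ℚ.∣ r ∣ (ℚ.nonNegative⁻¹ 1ℚ))

  scaled : ∀ ε → 0ℚ ℚ.< ε → ∀ y z → ℚ.∣ y ℚ.- z ∣ ℚ.≤ δ ε →
           ℚ.∣ y ℚ.* r ℚ.- z ℚ.* r ∣ ℚ.≤ ε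
  scaled ε 0<ε y z near = begin
    ℚ.∣ y ℚ.* r ℚ.- z ℚ.* r ∣   ≡⟨ cong ℚ.∣_∣ (solve 3 (λ y z r → y :* r :- z :* r := (y :- z) :* r) refl y z r) ⟩
    ℚ.∣ (y ℚ.- z) ℚ.* r ∣       ≡⟨ ℚ.∣p*q∣≡∣p∣*∣q∣ (y ℚ.- z) r ⟩
    ℚ.∣ y ℚ.- z ∣ ℚ.* ℚ.∣ r ∣   ≤⟨ ℚ.*-monoʳ-≤-nonNeg ℚ.∣ r ∣ {{ℚ.∣-∣-nonNeg r}} near ⟩
    δ ε ℚ.* ℚ.∣ r ∣             ≤⟨ ℚ.*-monoˡ-≤-nonNeg (δ ε) {{ℚ.nonNegative (ℚ.<⇒≤ (0<δ ε 0<ε))}} ∣r∣≤b ⟩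
    ε ℚ.* ℚ.1/ b ℚ.* b          ≡⟨ ℚ.*-assoc ε (ℚ.1/ b) b ⟩
    ε ℚ.* (ℚ.1/ b ℚ.* b)        ≡⟨ cong (ε ℚ.*_) (ℚ.*-inverseˡ b) ⟩
    ε ℚ.* 1ℚ                    ≡⟨ ℚ.*-identityʳ ε ⟩
    ε                           ∎
    where open ℚ.≤-Reasoning
          open +-*-Solver

1/_! : ℕ → ℚ
1/ k ! = (+ 1 ℚ./ (k !)) {{k !≢0}}

expSum : ℕ → ℚ
expSum zero    = 1/ 0 !
expSum (suc N) = expSum N ℚ.+ 1/ suc N !

private
  toℚᵘ-/ : ∀ i n .{{_ : ℕ.NonZero n}} → ℚ.toℚᵘ (i ℚ./ n) ℚᵘ.≃ (i ℚᵘ./ n)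
  toℚᵘ-/ i (suc n) = ℚ.toℚᵘ-fromℚᵘ (ℚᵘ.mkℚᵘ i n)

  0≤1/n : ∀ n .{{_ : ℕ.NonZero n}} → 0ℚ ℚ.≤ + 1 ℚ./ n
  0≤1/n n = ℚ.nonNegative⁻¹ _ {{ℚ.normalize-nonNeg 1 n}}

  halving : ∀ a b .{{_ : ℕ.NonZero a}} .{{_ : ℕ.NonZero b}} → 2 ℕ.* b ℕ.≤ a →
            (+ 1 ℚ./ a) ℚ.+ (+ 1 ℚ./ a) ℚ.≤ + 1 ℚ./ b
  halving a@(suc a′) b@(suc b′) 2b≤a = ℚ.toℚᵘ-cancel-≤ (begin
    ℚ.toℚᵘ ((+ 1 ℚ./ a) ℚ.+ (+ 1 ℚ./ a))
      ≃⟨ ℚ.toℚᵘ-homo-+ (+ 1 ℚ./ a) (+ 1 ℚ./ a) ⟩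
    ℚ.toℚᵘ (+ 1 ℚ./ a) ℚᵘ.+ ℚ.toℚᵘ (+ 1 ℚ./ a)
      ≃⟨ ℚᵘ.+-cong (toℚᵘ-/ (+ 1) a) (toℚᵘ-/ (+ 1) a) ⟩
    (+ 1 ℚᵘ./ a) ℚᵘ.+ (+ 1 ℚᵘ./ a)
      ≤⟨ ℚᵘ.*≤* (ℤ.+≤+ cross) ⟩
    + 1 ℚᵘ./ b
      ≃⟨ toℚᵘ-/ (+ 1) b ⟨
    ℚ.toℚᵘ (+ 1 ℚ./ b) ∎)
    where
    open ℚᵘ.≤-Reasoning
    cross : (1 ℕ.* a ℕ.+ 1 ℕ.* a) ℕ.* b ℕ.≤ 1 ℕ.* (a ℕ.* a)
    cross = ℕ.≤-trans (ℕ.≤-reflexive eq)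
              (ℕ.≤-trans (ℕ.*-monoʳ-≤ a 2b≤a) (ℕ.≤-reflexive (sym (ℕ.*-identityˡ (a ℕ.* a)))))
      where
      eq : (1 ℕ.* a ℕ.+ 1 ℕ.* a) ℕ.* b ≡ a ℕ.* (2 ℕ.* b)
      eq = trans (cong (ℕ._* b) (trans (sym (ℕ.*-distribʳ-+ a 1 1)) (ℕ.*-comm 2 a)))
                 (ℕ.*-assoc a 2 b)

  1/n≤ : ∀ ε → 0ℚ ℚ.< ε → ∀ n .{{_ : ℕ.NonZero n}} → ↧ₙ ε ℕ.≤ n → + 1 ℚ./ n ℚ.≤ ε
  1/n≤ (mkℚ (ℤ.+[1+ a ]) d-1 _) 0<ε n@(suc _) d≤n = ℚ.toℚᵘ-cancel-≤ (begin
    ℚ.toℚᵘ (+ 1 ℚ./ n)         ≃⟨ toℚᵘ-/ (+ 1) n ⟩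
    + 1 ℚᵘ./ n                 ≤⟨ ℚᵘ.*≤* (ℤ.+≤+ (ℕ.*-mono-≤ {1} {suc a} (ℕ.s≤s ℕ.z≤n) d≤n)) ⟩
    ℚᵘ.mkℚᵘ (ℤ.+[1+ a ]) d-1   ∎)
    where open ℚᵘ.≤-Reasoning
  1/n≤ (mkℚ (+ 0) _ _)        (ℚ.*<* (ℤ.+<+ ()))
  1/n≤ (mkℚ (ℤ.-[1+ _ ]) _ _) (ℚ.*<* ())

  n≤n! : ∀ n → n ℕ.≤ n !
  n≤n! zero    = ℕ.z≤n
  n≤n! (suc n) = ℕ.≤-trans (ℕ.≤-reflexive (sym (ℕ.*-identityʳ (suc n))))
                   (ℕ.*-monoʳ-≤ (suc n) (ℕ.>-nonZero⁻¹ (n !) {{n !≢0}}))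

  1/!-halving : ∀ k → 1 ℕ.≤ k → (1/ suc k !) ℚ.+ (1/ suc k !) ℚ.≤ 1/ k !
  1/!-halving k 1≤k =
    halving (suc k !) (k !) {{suc k !≢0}} {{k !≢0}} (ℕ.*-monoˡ-≤ (k !) (ℕ.s≤s 1≤k))

  expSum-mono : ∀ {N i} → N ℕ.≤′ i → expSum N ℚ.≤ expSum i
  expSum-mono ℕ.≤′-refl = ℚ.≤-refl
  expSum-mono {N} (ℕ.≤′-step {i} N≤i) = ℚ.≤-trans (expSum-mono N≤i)
    (subst (ℚ._≤ expSum (suc i)) (ℚ.+-identityʳ (expSum i))
      (ℚ.+-monoʳ-≤ (expSum i) (0≤1/n (suc i !) {{suc i !≢0}})))

  expSum-upper : ∀ {N i} → 1 ℕ.≤ N → N ℕ.≤′ i →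
                 expSum i ℚ.+ (1/ i !) ℚ.≤ expSum N ℚ.+ (1/ N !)
  expSum-upper 1≤N ℕ.≤′-refl = ℚ.≤-refl
  expSum-upper {N} 1≤N (ℕ.≤′-step {i} N≤i) = ℚ.≤-trans
    (subst (ℚ._≤ expSum i ℚ.+ (1/ i !))
      (sym (ℚ.+-assoc (expSum i) (1/ suc i !) (1/ suc i !)))
      (ℚ.+-monoʳ-≤ (expSum i) (1/!-halving i (ℕ.≤-trans 1≤N (ℕ.≤′⇒≤ N≤i)))))
    (expSum-upper 1≤N N≤i)

  expSum-bound : ∀ {N i} → 1 ℕ.≤ N → N ℕ.≤ i → expSum i ℚ.≤ expSum N ℚ.+ (1/ N !)
  expSum-bound {N} {i} 1≤N N≤i = ℚ.≤-trans
    (subst (ℚ._≤ expSum i ℚ.+ (1/ i !)) (ℚ.+-identityʳ (expSum i))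
      (ℚ.+-monoʳ-≤ (expSum i) (0≤1/n (i !) {{i !≢0}})))
    (expSum-upper 1≤N (ℕ.≤⇒≤′ N≤i))

  diff≤ : ∀ {a w x y} → a ℚ.≤ y → x ℚ.≤ a ℚ.+ w → x ℚ.- y ℚ.≤ w
  diff≤ {a} {w} {x} {y} a≤y x≤a+w = subst (x ℚ.- y ℚ.≤_)
    (solve 2 (λ a w → a :+ w :- a := w) refl a w)
    (ℚ.+-mono-≤ x≤a+w (ℚ.neg-antimono-≤ a≤y))
    where open +-*-Solver

  ∣diff∣≤ : ∀ {a w x y} → a ℚ.≤ x → x ℚ.≤ a ℚ.+ w → a ℚ.≤ y → y ℚ.≤ a ℚ.+ w →
            ℚ.∣ x ℚ.- y ∣ ℚ.≤ w
  ∣diff∣≤ {a} {w} {x} {y} a≤x x≤ a≤y y≤ with ℚ.∣p∣≡p∨∣p∣≡-p (x ℚ.- y)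
  ... | inj₁ eq = subst (ℚ._≤ w) (sym eq) (diff≤ a≤y x≤)
  ... | inj₂ eq = subst (ℚ._≤ w)
    (trans (solve 2 (λ x y → y :- x := :- (x :- y)) refl x y) (sym eq)) (diff≤ a≤x y≤)
    where open +-*-Solver

-- e = Σ_{k ≥ 0} 1/k!
e : ℝ
e = record { seq = expSum ; cauchy = expSum-cauchy }
  where
  expSum-cauchy : ∀ ε → 0ℚ ℚ.< ε → ∃ λ N → ∀ i j → N ℕ.≤ i → N ℕ.≤ j →
                  ℚ.∣ expSum i ℚ.- expSum j ∣ ℚ.≤ ε
  expSum-cauchy ε 0<ε = N , λ i j N≤i N≤j → ℚ.≤-trans
      (∣diff∣≤ (expSum-mono (ℕ.≤⇒≤′ N≤i)) (expSum-bound 1≤N N≤i)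
               (expSum-mono (ℕ.≤⇒≤′ N≤j)) (expSum-bound 1≤N N≤j))
      (1/n≤ ε 0<ε (N !) {{N !≢0}} (n≤n! N))
    where
    N = ↧ₙ ε
    1≤N : 1 ℕ.≤ N
    1≤N = ℕ.s≤s ℕ.z≤n

IsPrimePower : ℕ → Set
IsPrimePower q = ∃₂ λ p k → Prime p × 1 ℕ.≤ k × q ≡ p ℕ.^ k

-- 𝔽_q is any (Heyting) field whose carrier, up to _≈_, is in bijection with Fin q;
-- such a field is unique up to isomorphism.
record FiniteField (q : ℕ) c ℓ₁ ℓ₂ : Set (lsuc (c ⊔ ℓ₁ ⊔ ℓ₂)) where
  field
    heytingField : HeytingField c ℓ₁ ℓ₂

  commutativeRing : CommutativeRing c ℓ₁
  commutativeRing =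
    HeytingCommutativeRing.commutativeRing (HeytingField.heytingCommutativeRing heytingField)

  field
    enumeration : Inverse (CommutativeRing.setoid commutativeRing) (setoid (Fin q))

infixl 8 _^ᴿ_

_^ᴿ_ : ∀ {c ℓ} → CommutativeRing c ℓ → ℕ → CommutativeRing c ℓ
R ^ᴿ n = Pointwise.commutativeRing (Fin n) R

-- Lists (g_{i₁}, …, g_{i_m}), one for each tuple of positions i₁ < ⋯ < i_m.
combinations : ∀ {a} {A : Set a} → ℕ → List A → List (List A)
combinations zero    gs       = [] ∷ []
combinations (suc m) []       = []
combinations (suc m) (g ∷ gs) = map (g ∷_) (combinations m gs) ++ combinations (suc m) gs

ℕ∞ : Set
ℕ∞ = ℕ ⁺

open SupStrict ℕ._<_ public using () renaming (_<⁺_ to _<∞_)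

module _ {c ℓ} (R : CommutativeRing c ℓ) where
  open CommutativeRing R using (Carrier; _≈_; _+_; _*_; 0#; 1#)

  esym : ℕ → List Carrier → Carrier
  esym m gs = foldr _+_ 0# (map (foldr _*_ 1#) (combinations m gs))

  -- _⊆_ is the order-preserving sublist relation, so repeated elements of S
  -- are told apart by their positions.
  ForcesZero : (t m l : ℕ) → Set (c ⊔ ℓ)
  ForcesZero t m l = ∀ (S : List Carrier) → l ℕ.≤ length S →
    ∃ λ S′ → S′ ⊆ S × length S′ ≡ t × esym m S′ ≈ 0#

  -- IsEGZ t m v says that v is the value of EGZ(t, R, m).  EGZ is given by its
  -- graph, as choosing between the two clauses is not effective in general;
  -- IsEGZ-unique and IsEGZ-¬¬exists show that it describes one value.
  IsEGZ : (t m : ℕ) → ℕ∞ → Set (c ⊔ ℓ)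
  IsEGZ t m Sup.[ l ] = 1 ℕ.≤ l × ForcesZero t m l ×
                        (∀ j → 1 ℕ.≤ j → ForcesZero t m j → l ℕ.≤ j)
  IsEGZ t m ⊤⁺        = ∀ j → 1 ℕ.≤ j → ¬ ForcesZero t m j

  IsEGZ-unique : ∀ {t m} v w → IsEGZ t m v → IsEGZ t m w → v ≡ w
  IsEGZ-unique Sup.[ l ] Sup.[ k ] (1≤l , fl , min-l) (1≤k , fk , min-k) =
    cong Sup.[_] (ℕ.≤-antisym (min-l k 1≤k fk) (min-k l 1≤l fl))
  IsEGZ-unique Sup.[ l ] ⊤⁺        (1≤l , fl , _) none = ⊥-elim (none l 1≤l fl)
  IsEGZ-unique ⊤⁺        Sup.[ k ] none (1≤k , fk , _) = ⊥-elim (none k 1≤k fk)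
  IsEGZ-unique ⊤⁺        ⊤⁺        _ _ = refl

  IsEGZ-¬¬exists : ∀ t m → ¬ ¬ ∃ (IsEGZ t m)
  IsEGZ-¬¬exists t m ∄ = ∄ (⊤⁺ , none)
    where
    none : ∀ j → 1 ℕ.≤ j → ¬ ForcesZero t m j
    none = <-rec (λ j → 1 ℕ.≤ j → ¬ ForcesZero t m j) λ j rec 1≤j fj →
      ∄ (Sup.[ j ] , 1≤j , fj , λ k 1≤k fk → ℕ.≮⇒≥ λ k<j → rec k<j 1≤k fk)

{-# OPTIONS --safe #-}

-- Rosenfeld's counting argument takes the place of the Lovász local lemma.  Put
-- t = j + 1, Q = q^n, c_k = C(k, j), D = C(l, t) - C(l - t, t), and let N_k count the
-- words of length k over 𝔽_q^n with no t-subsequence on which e_m vanishes.  If such a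
-- word of length k stops being good when a letter is put in front, then that letter and
-- some j others form a zero of e_m, and the k - j remaining letters form a good word:
--   Q N_k ≤ N_{k+1} + c_k B N_{k-j},   B = number of zeros of e_m in (𝔽_q^n)^t.
-- As e_m is affine in its first argument, with slope e_{m-1} of the others, at most
-- m q^(t-1) words of length t over 𝔽_q are zeros, so B ≤ m^n Q^j.  With y = D/(D+1) one
-- gets N_{k+1} ≥ Q y^(c_k) N_k for k < l by induction: the c_i for k - j ≤ i ≤ k sum to
-- at most D, 1 - y^c ≥ c (1 - y) y^(c-1), and (1 - y) y^(D-1) ≥ (m/q)^n follows from
-- the hypothesis through (1 + 1/D)^D ≤ e.  Hence N_l > 0.

module Submission where

open import Defs
open import Data.Integer.Base as ℤ using (+_)
open import Data.Nat.Base as ℕ using (ℕ; NonZero)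
open import Data.Nat.Combinatorics using (_C_)
open import Data.Rational.Base as ℚ using (ℚ; 1ℚ; _/_)
open import Relation.Nullary.Construct.Add.Supremum using ([_])

open import Algebra.Apartness.Bundles using (HeytingField)
open import Algebra.Bundles using (CommutativeRing)
import Algebra.Properties.Ring as RingProperties
open import Data.Bool.Base using (if_then_else_)
open import Data.Fin.Base as Fin using (Fin)
import Data.Fin.Properties as Fin
import Data.Integer.Properties as ℤ
open import Data.List.Base using (List; []; _∷_; _++_; map; length; cartesianProductWith; foldr; zipWith; allFin; replicate)
open import Data.List.Membership.Propositional using (_∈_; find)
open import Data.List.Membership.Propositional.Properties using (∈-map⁺; ∈-map⁻; ∈-++⁺ˡ; ∈-++⁺ʳ; ∈-++⁻)
open import Data.List.Properties using (map-++; map-∘; map-cong; length-map; length-tabulate; length-++; length-replicate)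
open import Data.List.Relation.Binary.Sublist.Propositional using (_⊆_; []; _∷_; _∷ʳ_; ⊆-refl)
open import Data.List.Relation.Binary.Sublist.Propositional.Properties
  using (All-resp-⊆; ++⁺; ++⁺ˡ; length-mono-≤) renaming (map⁺ to ⊆-map⁺)
open import Data.List.Relation.Unary.All as All using (All; all?; []; _∷_)
open import Data.List.Relation.Unary.All.Properties using (¬All⇒Any¬; map⁺) renaming (++⁺ to All-++⁺)
open import Data.List.Relation.Unary.AllPairs using (AllPairs; []; _∷_)
open import Data.List.Relation.Unary.Any using (here; there)
import Data.List.Relation.Unary.Unique.Propositional.Properties as UniqueP
import Data.List.Relation.Unary.Unique.Setoid.Properties as Unique
open import Data.Nat.Base using (zero; suc; _≤_; _<_; z≤n; s≤s; _^_; _!)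
open import Data.Nat.Combinatorics using (nCk≡nC[n∸k]; nCn≡1; k>n⇒nCk≡0; nCk+nC[k+1]≡[n+1]C[k+1])
open import Data.Nat.Induction using (<-rec)
open import Data.Nat.ListAction using (sum)
open import Data.Nat.ListAction.Properties using (sum-++)
open import Data.Nat.Properties as ℕ using (≤-refl; ≤-trans; ≤-reflexive)
open import Data.Nat.Tactic.RingSolver using (solve-∀)
open import Data.Product.Base using (_×_; _,_; ∃; proj₁; proj₂; map₁; map₂)
open import Data.Rational.Base using (0ℚ)
import Data.Rational.Properties as ℚ
open import Data.Rational.Solver using (module +-*-Solver)
import Data.Rational.Unnormalised.Base as ℚᵘ
import Data.Rational.Unnormalised.Properties as ℚᵘ
open import Data.Sum.Base using (inj₁; inj₂)
import Data.Vec.Functional as Vector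
open import Function.Base using (_∘_)
open import Function.Bundles using (Inverse)
open import Level using (Level)
import Relation.Binary.Construct.Add.Supremum.Strict as SupStrict
open import Relation.Binary.PropositionalEquality as ≡ using (_≡_; refl; cong; cong₂; subst; subst₂)
open import Relation.Nullary using (Dec; does; yes; no; ¬_; ¬?; contradiction; decidable-stable)
open import Relation.Nullary.Construct.Add.Supremum using (⊤⁺)
open import Relation.Nullary.Decidable using (map′)
open import Relation.Unary using (Pred; Decidable)

private variable
  ℓa ℓb ℓw ℓx ℓy : Level
  A : Set ℓa
  B : Set ℓb
  W : Set ℓw
  X : Set ℓx
  Y : Set ℓy

module WordCounting where
  open import Data.Nat.Base using (_+_; _*_; _∸_)
  open import Data.Nat.Properties
  open import Relation.Binary.PropositionalEquality using (sym; trans)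

  ∑ : List A → (A → ℕ) → ℕ
  ∑ xs f = sum (map f xs)

  ⟦_⟧ : Dec Y → ℕ
  ⟦ d ⟧ = if does d then 1 else 0

  ⟦⟧-mono : (x? : Dec X) (y? : Dec Y) → (X → Y) → ⟦ x? ⟧ ≤ ⟦ y? ⟧
  ⟦⟧-mono (yes x) (yes y) _   = ≤-refl
  ⟦⟧-mono (yes x) (no ¬y) x⇒y = contradiction (x⇒y x) ¬y
  ⟦⟧-mono (no ¬x) y?      _   = z≤n

  ⟦⟧≤1 : (d : Dec Y) → ⟦ d ⟧ ≤ 1
  ⟦⟧≤1 (yes _) = ≤-refl
  ⟦⟧≤1 (no _)  = z≤n

  ⟦⟧-yes : (d : Dec Y) → Y → ⟦ d ⟧ ≡ 1
  ⟦⟧-yes (yes _) y = refl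
  ⟦⟧-yes (no ¬y) y = contradiction y ¬y

  ⟦⟧-positive : (d : Dec Y) → 0 < ⟦ d ⟧ → Y
  ⟦⟧-positive (yes y) _ = y

  ∑-cong : {f g : A → ℕ} (xs : List A) → (∀ x → f x ≡ g x) → ∑ xs f ≡ ∑ xs g
  ∑-cong xs f≗g = cong sum (map-cong f≗g xs)

  ∑-mono : {f g : A → ℕ} (xs : List A) → (∀ x → f x ≤ g x) → ∑ xs f ≤ ∑ xs g
  ∑-mono []       f≤g = z≤n
  ∑-mono (x ∷ xs) f≤g = +-mono-≤ (f≤g x) (∑-mono xs f≤g)

  ∑-+ : (xs : List A) (f g : A → ℕ) → ∑ xs (λ x → f x + g x) ≡ ∑ xs f + ∑ xs g
  ∑-+ []       f g = refl
  ∑-+ (x ∷ xs) f g rewrite ∑-+ xs f g = interchange (f x) (g x) (∑ xs f) (∑ xs g)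
    where
    interchange : ∀ p q r s → p + q + (r + s) ≡ p + r + (q + s)
    interchange = solve-∀

  ∑-*ˡ : ∀ k (xs : List A) (f : A → ℕ) → ∑ xs (λ x → k * f x) ≡ k * ∑ xs f
  ∑-*ˡ k []       f = sym (*-zeroʳ k)
  ∑-*ˡ k (x ∷ xs) f rewrite ∑-*ˡ k xs f = sym (*-distribˡ-+ k (f x) (∑ xs f))

  ∑-*ʳ : ∀ k (xs : List A) (f : A → ℕ) → ∑ xs (λ x → f x * k) ≡ ∑ xs f * k
  ∑-*ʳ k xs f = trans (∑-cong xs (λ x → *-comm (f x) k))
                  (trans (∑-*ˡ k xs f) (*-comm k (∑ xs f)))

  ∑-const : ∀ k (xs : List A) → ∑ xs (λ _ → k) ≡ length xs * k
  ∑-const k []       = refl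
  ∑-const k (x ∷ xs) = cong (λ n → k + n) (∑-const k xs)

  ∑-swap : (xs : List A) (ys : List B) (f : A → B → ℕ) →
           ∑ xs (λ x → ∑ ys (f x)) ≡ ∑ ys (λ y → ∑ xs (λ x → f x y))
  ∑-swap []       ys f = sym (trans (∑-const 0 ys) (*-zeroʳ (length ys)))
  ∑-swap (x ∷ xs) ys f rewrite ∑-swap xs ys f = sym (∑-+ ys (f x) (λ y → ∑ xs (λ x → f x y)))

  ∑-map : (g : A → B) (xs : List A) (f : B → ℕ) → ∑ (map g xs) f ≡ ∑ xs (f ∘ g)
  ∑-map g xs f = cong sum (sym (map-∘ xs))

  ∑-++ : (xs ys : List A) (f : A → ℕ) → ∑ (xs ++ ys) f ≡ ∑ xs f + ∑ ys f
  ∑-++ xs ys f rewrite map-++ f xs ys = sum-++ (map f xs) (map f ys)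

  ∑-cartesianProductWith : ∀ (g : A → B → W) xs ys (f : W → ℕ) →
    ∑ (cartesianProductWith g xs ys) f ≡ ∑ xs (λ x → ∑ ys (λ y → f (g x y)))
  ∑-cartesianProductWith g []       ys f = refl
  ∑-cartesianProductWith g (x ∷ xs) ys f =
    trans (∑-++ (map (g x) ys) _ f) (cong₂ _+_ (∑-map (g x) ys f) (∑-cartesianProductWith g xs ys f))

  ∑-term : {xs : List A} {x : A} (f : A → ℕ) → x ∈ xs → f x ≤ ∑ xs f
  ∑-term              f (here refl) = m≤m+n (f _) _
  ∑-term {xs = y ∷ _} f (there x∈)  = ≤-trans (∑-term f x∈) (m≤n+m _ (f y))

  words : ℕ → List A → List (List A)
  words zero    as = [] ∷ []
  words (suc k) as = cartesianProductWith _∷_ as (words k as)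

  ∑-words-suc : ∀ k (as : List A) (f : List A → ℕ) →
    ∑ (words (suc k) as) f ≡ ∑ as (λ x → ∑ (words k as) (λ w → f (x ∷ w)))
  ∑-words-suc k as = ∑-cartesianProductWith _∷_ as (words k as)

  ∑-words-mono : ∀ k (as : List A) {f g : List A → ℕ} →
    (∀ w → length w ≡ k → f w ≤ g w) → ∑ (words k as) f ≤ ∑ (words k as) g
  ∑-words-mono zero    as f≤g = +-mono-≤ (f≤g [] refl) z≤n
  ∑-words-mono (suc k) as {f} {g} f≤g = subst₂ _≤_ (sym (∑-words-suc k as f)) (sym (∑-words-suc k as g))
    (∑-mono as λ x → ∑-words-mono k as λ w eq → f≤g (x ∷ w) (cong suc eq))

  ∑-words-const : ∀ k (as : List A) → ∑ (words k as) (λ _ → 1) ≡ length as ^ k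
  ∑-words-const zero    as = refl
  ∑-words-const (suc k) as = trans (∑-words-suc k as _)
    (trans (∑-const _ as) (cong (length as *_) (∑-words-const k as)))

  words-positive : ∀ k (as : List A) (f : List A → ℕ) → 0 < ∑ (words k as) f →
                   ∃ λ w → length w ≡ k × 0 < f w
  words-positive zero    as f 0<∑ = [] , refl , subst (0 <_) (+-identityʳ (f [])) 0<∑
  words-positive (suc k) as f 0<∑ = extend as (subst (0 <_) (∑-words-suc k as f) 0<∑)
    where
    extend : ∀ xs → 0 < ∑ xs (λ x → ∑ (words k as) (λ w → f (x ∷ w))) →
             ∃ λ w → length w ≡ suc k × 0 < f w
    extend (x ∷ xs) 0<∑ with ∑ (words k as) (λ w → f (x ∷ w)) in eq
    ... | zero  = extend xs 0<∑
    ... | suc _ = let w , ∣w∣≡k , 0<f = words-positive k as _ (subst (0 <_) (sym eq) (s≤s z≤n))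
                  in  x ∷ w , cong suc ∣w∣≡k , 0<f

  splits : ℕ → List A → List (List A × List A)
  splits zero    xs       = ([] , xs) ∷ []
  splits (suc j) []       = []
  splits (suc j) (x ∷ xs) = map (map₁ (x ∷_)) (splits j xs) ++ map (map₂ (x ∷_)) (splits (suc j) xs)

  splits-⊆ : ∀ j (xs : List A) {u v} → (u , v) ∈ splits j xs → v ⊆ xs
  splits-⊆ zero    xs       (here refl) = ⊆-refl
  splits-⊆ (suc j) (x ∷ xs) uv∈ with ∈-++⁻ (map (map₁ (x ∷_)) (splits j xs)) uv∈
  ... | inj₁ uv∈ˡ with ∈-map⁻ _ uv∈ˡ
  ...   | _ , uv∈′ , refl = x ∷ʳ splits-⊆ j xs uv∈′
  splits-⊆ (suc j) (x ∷ xs) uv∈ | inj₂ uv∈ʳ with ∈-map⁻ _ uv∈ʳ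
  ...   | _ , uv∈′ , refl = refl ∷ splits-⊆ (suc j) xs uv∈′

  combinations-split : ∀ j (xs : List A) {u} → u ∈ combinations j xs → ∃ λ v → (u , v) ∈ splits j xs
  combinations-split zero    xs       (here refl) = xs , here refl
  combinations-split (suc j) (x ∷ xs) u∈ with ∈-++⁻ (map (x ∷_) (combinations j xs)) u∈
  ... | inj₁ u∈ˡ with ∈-map⁻ _ u∈ˡ
  ...   | u′ , u′∈ , refl = let v , uv∈ = combinations-split j xs u′∈
                            in  v , ∈-++⁺ˡ (∈-map⁺ (map₁ (x ∷_)) uv∈)
  combinations-split (suc j) (x ∷ xs) u∈ | inj₂ u∈ʳ =
    let v , uv∈ = combinations-split (suc j) xs u∈ʳ
    in  x ∷ v , ∈-++⁺ʳ (map (map₁ (x ∷_)) (splits j xs)) (∈-map⁺ (map₂ (x ∷_)) uv∈)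

  combinations-mono-⊆ : ∀ j {xs ys : List A} → xs ⊆ ys → combinations j xs ⊆ combinations j ys
  combinations-mono-⊆ zero    _            = ⊆-refl
  combinations-mono-⊆ (suc j) []           = []
  combinations-mono-⊆ (suc j) (y ∷ʳ xs⊆ys) =
    ++⁺ˡ (map (y ∷_) (combinations j _)) (combinations-mono-⊆ (suc j) xs⊆ys)
  combinations-mono-⊆ (suc j) (_∷_ {x = x} refl xs⊆ys) =
    ++⁺ (⊆-map⁺ (x ∷_) (combinations-mono-⊆ j xs⊆ys)) (combinations-mono-⊆ (suc j) xs⊆ys)

  ⊆⇒∈-combinations : {xs ys : List A} → xs ⊆ ys → xs ∈ combinations (length xs) ys
  ⊆⇒∈-combinations {xs = []}          _               = here refl
  ⊆⇒∈-combinations {xs = x ∷ xs}      (y ∷ʳ xs⊆ys)    =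
    ∈-++⁺ʳ (map (y ∷_) (combinations (length xs) _)) (⊆⇒∈-combinations xs⊆ys)
  ⊆⇒∈-combinations {xs = x ∷ xs}      (refl ∷ xs⊆ys)  = ∈-++⁺ˡ (∈-map⁺ (x ∷_) (⊆⇒∈-combinations xs⊆ys))

  nC0≡1 : ∀ n → n C 0 ≡ 1
  nC0≡1 n = trans (nCk≡nC[n∸k] {0} {n} z≤n) (nCn≡1 n)

  ∑-words-splits : ∀ k j (as : List A) (F : List A × List A → ℕ) →
    ∑ (words k as) (λ w → ∑ (splits j w) F) ≡
    (k C j) * ∑ (words j as) (λ u → ∑ (words (k ∸ j) as) (λ v → F (u , v)))
  ∑-words-splits k zero as F rewrite nC0≡1 k
    | +-identityʳ (∑ (words k as) (λ v → F ([] , v)))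
    | +-identityʳ (∑ (words k as) (λ v → F ([] , v)))
    = ∑-cong (words k as) (λ w → +-identityʳ _)
  ∑-words-splits zero (suc j) as F = refl
  ∑-words-splits (suc k) (suc j) as F = begin
    ∑ (words (suc k) as) (λ w → ∑ (splits (suc j) w) F)
      ≡⟨ ∑-words-suc k as _ ⟩
    ∑ as (λ x → ∑ (words k as) (λ w → ∑ (splits (suc j) (x ∷ w)) F))
      ≡⟨ ∑-cong as (λ x → trans (∑-cong (words k as) (split x)) (∑-+ (words k as) _ _)) ⟩
    ∑ as (λ x → ∑ (words k as) (λ w → ∑ (splits j w) (F ∘ map₁ (x ∷_)))
              + ∑ (words k as) (λ w → ∑ (splits (suc j) w) (F ∘ map₂ (x ∷_))))
      ≡⟨ ∑-cong as (λ x → cong₂ _+_ (∑-words-splits k j as _) (∑-words-splits k (suc j) as _)) ⟩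
    ∑ as (λ x → (k C j) * headIn x + (k C suc j) * headOut x)
      ≡⟨ ∑-+ as _ _ ⟩
    ∑ as (λ x → (k C j) * headIn x) + ∑ as (λ x → (k C suc j) * headOut x)
      ≡⟨ cong₂ _+_ (∑-*ˡ (k C j) as headIn) (∑-*ˡ (k C suc j) as headOut) ⟩
    (k C j) * ∑ as headIn + (k C suc j) * ∑ as headOut
      ≡⟨ cong₂ _+_ (cong ((k C j) *_) (sym (∑-words-suc j as _))) out ⟩
    (k C j) * total + (k C suc j) * total
      ≡⟨ *-distribʳ-+ total (k C j) (k C suc j) ⟨
    (k C j + k C suc j) * total
      ≡⟨ cong (_* total) (nCk+nC[k+1]≡[n+1]C[k+1] k j) ⟩
    (suc k C suc j) * total ∎
    where
    open ≡.≡-Reasoning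
    headIn headOut : _ → ℕ
    headIn  x = ∑ (words j as) (λ u → ∑ (words (k ∸ j) as) (λ v → F (x ∷ u , v)))
    headOut x = ∑ (words (suc j) as) (λ u → ∑ (words (k ∸ suc j) as) (λ v → F (u , x ∷ v)))
    total = ∑ (words (suc j) as) (λ u → ∑ (words (k ∸ j) as) (λ v → F (u , v)))
    split : ∀ x w → ∑ (splits (suc j) (x ∷ w)) F ≡
            ∑ (splits j w) (F ∘ map₁ (x ∷_)) + ∑ (splits (suc j) w) (F ∘ map₂ (x ∷_))
    split x w = trans (∑-++ (map (map₁ (x ∷_)) (splits j w)) _ F)
      (cong₂ _+_ (∑-map (map₁ (x ∷_)) (splits j w) F) (∑-map (map₂ (x ∷_)) (splits (suc j) w) F))
    out : (k C suc j) * ∑ as headOut ≡ (k C suc j) * total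
    out with j <? k
    ... | no  j≮k rewrite k>n⇒nCk≡0 (s≤s (≮⇒≥ j≮k)) = refl
    ... | yes j<k rewrite +-∸-assoc 1 j<k = cong ((k C suc j) *_)
      (trans (∑-swap as (words (suc j) as) _)
             (∑-cong (words (suc j) as) (λ u → sym (∑-words-suc (k ∸ suc j) as _))))

  module Avoiding {A : Set ℓa} (as : List A) {Z : Pred (List A) ℓx} (Z? : Decidable Z) (j : ℕ) where

    Avoids : List A → Set _
    Avoids w = All (¬_ ∘ Z) (combinations (suc j) w)

    avoids? : Decidable Avoids
    avoids? w = all? (¬? ∘ Z?) (combinations (suc j) w)

    #avoiding : ℕ → ℕ
    #avoiding k = ∑ (words k as) (λ w → ⟦ avoids? w ⟧)

    #zeros : ℕ
    #zeros = ∑ (words (suc j) as) (λ w → ⟦ Z? w ⟧)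

    private
      bad : A → List A × List A → ℕ
      bad x (u , v) = ⟦ Z? (x ∷ u) ⟧ * ⟦ avoids? v ⟧

      extension : ∀ x w → ⟦ avoids? w ⟧ ≤ ⟦ avoids? (x ∷ w) ⟧ + ∑ (splits j w) (bad x)
      extension x w with avoids? w | avoids? (x ∷ w)
      ... | no _  | _     = z≤n
      ... | yes _ | yes _ = s≤s z≤n
      ... | yes g | no ¬g with all? (λ u → ¬? (Z? (x ∷ u))) (combinations j w)
      ...   | yes h = contradiction (All-++⁺ (map⁺ h) g) ¬g
      ...   | no ¬h = ≤-trans (≤-reflexive (sym bad≡1)) (∑-term (bad x) (proj₂ rest))
        where
        zero∈ : ∃ λ u → u ∈ combinations j w × ¬ ¬ Z (x ∷ u)
        zero∈ = find (¬All⇒Any¬ (λ u → ¬? (Z? (x ∷ u))) _ ¬h)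
        u = proj₁ zero∈
        rest : ∃ λ v → (u , v) ∈ splits j w
        rest = combinations-split j w (proj₁ (proj₂ zero∈))
        bad≡1 : bad x (u , proj₁ rest) ≡ 1
        bad≡1 = cong₂ _*_
          (⟦⟧-yes (Z? (x ∷ u)) (decidable-stable (Z? (x ∷ u)) (proj₂ (proj₂ zero∈))))
          (⟦⟧-yes (avoids? (proj₁ rest))
            (All-resp-⊆ (combinations-mono-⊆ (suc j) (splits-⊆ j w (proj₂ rest))) g))

    #avoiding-step : ∀ k → length as * #avoiding k ≤
                     #avoiding (suc k) + (k C j) * (#zeros * #avoiding (k ∸ j))
    #avoiding-step k = begin
      length as * #avoiding k
        ≡⟨ ∑-const (#avoiding k) as ⟨
      ∑ as (λ _ → #avoiding k)
        ≤⟨ ∑-mono as (λ x → ∑-mono (words k as) (extension x)) ⟩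
      ∑ as (λ x → ∑ (words k as) (λ w → ⟦ avoids? (x ∷ w) ⟧ + ∑ (splits j w) (bad x)))
        ≡⟨ ∑-cong as (λ x → ∑-+ (words k as) _ _) ⟩
      ∑ as (λ x → ∑ (words k as) (λ w → ⟦ avoids? (x ∷ w) ⟧) + ∑ (words k as) (λ w → ∑ (splits j w) (bad x)))
        ≡⟨ ∑-+ as _ _ ⟩
      ∑ as (λ x → ∑ (words k as) (λ w → ⟦ avoids? (x ∷ w) ⟧)) + ∑ as (λ x → ∑ (words k as) (λ w → ∑ (splits j w) (bad x)))
        ≡⟨ cong₂ _+_ (sym (∑-words-suc k as _)) (∑-cong as λ x →
             trans (∑-words-splits k j as (bad x)) (cong ((k C j) *_) (product x))) ⟩
      #avoiding (suc k) + ∑ as (λ x → (k C j) * (zerosFrom x * #avoiding (k ∸ j)))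
        ≡⟨ cong (λ n → #avoiding (suc k) + n) (trans (∑-*ˡ (k C j) as _) (cong ((k C j) *_)
             (trans (∑-*ʳ (#avoiding (k ∸ j)) as zerosFrom)
                    (cong (_* #avoiding (k ∸ j)) (sym (∑-words-suc j as _)))))) ⟩
      #avoiding (suc k) + (k C j) * (#zeros * #avoiding (k ∸ j)) ∎
      where
      open ≤-Reasoning
      zerosFrom : A → ℕ
      zerosFrom x = ∑ (words j as) (λ u → ⟦ Z? (x ∷ u) ⟧)
      product : ∀ x → ∑ (words j as) (λ u → ∑ (words (k ∸ j) as) (λ v → bad x (u , v))) ≡
                zerosFrom x * #avoiding (k ∸ j)
      product x = trans (∑-cong (words j as) (λ u → ∑-*ˡ ⟦ Z? (x ∷ u) ⟧ (words (k ∸ j) as) _))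
                        (∑-*ʳ (#avoiding (k ∸ j)) (words j as) _)

open WordCounting

module ExponentialBound where
  open import Data.Nat.Base using (_+_; _*_; _∸_)
  open import Data.Nat.Properties
  open import Relation.Binary.PropositionalEquality using (sym; trans)

  C-monoˡ : ∀ n k → n C k ≤ suc n C k
  C-monoˡ n zero    = ≤-reflexive (trans (nC0≡1 n) (sym (nC0≡1 (suc n))))
  C-monoˡ n (suc k) = ≤-trans (m≤n+m (n C suc k) (n C k)) (≤-reflexive (nCk+nC[k+1]≡[n+1]C[k+1] n k))

  C-positive : ∀ k i → 1 ≤ (k + i) C k
  C-positive k zero    = ≤-reflexive (sym (trans (cong (_C k) (+-identityʳ k)) (nCn≡1 k)))
  C-positive k (suc i) = ≤-trans (C-positive k i)
    (subst (λ x → (k + i) C k ≤ x C k) (sym (+-suc k i)) (C-monoˡ (k + i) k))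

  column : (j r i : ℕ) → ℕ
  column j r zero    = 0
  column j r (suc i) = column j r i + (i + r) C j

  column-C : ∀ j r i → column j r i + r C suc j ≡ (i + r) C suc j
  column-C j r zero    = refl
  column-C j r (suc i) = begin
    column j r i + (i + r) C j + r C suc j   ≡⟨ swapʳ (column j r i) ((i + r) C j) (r C suc j) ⟩
    (i + r) C j + (column j r i + r C suc j) ≡⟨ cong (λ n → (i + r) C j + n) (column-C j r i) ⟩
    (i + r) C j + (i + r) C suc j            ≡⟨ nCk+nC[k+1]≡[n+1]C[k+1] (i + r) j ⟩
    (suc i + r) C suc j                      ∎
    where
    open ≡.≡-Reasoning
    swapʳ : ∀ a b c → a + b + c ≡ b + (a + c)
    swapʳ = solve-∀

  column-mono : ∀ j i {r s} → r ℕ.≤′ s → column j r i ≤ column j s i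
  column-mono j i ℕ.≤′-refl           = ≤-refl
  column-mono j i (ℕ.≤′-step {s} r≤s) = ≤-trans (column-mono j i r≤s) (step i)
    where
    step : ∀ i → column j s i ≤ column j (suc s) i
    step zero    = z≤n
    step (suc i) = +-mono-≤ (step i)
      (subst (λ x → (i + s) C j ≤ x C j) (sym (+-suc i s)) (C-monoˡ (i + s) j))

  power-gap : ∀ d c → suc c * d ^ c + d ^ suc c ≤ suc d ^ suc c
  power-gap d zero    = ≤-reflexive (sym (base d))
    where
    base : ∀ d → suc d * 1 ≡ 1 * 1 + d * 1
    base = solve-∀
  power-gap d (suc c) = begin
    suc (suc c) * d ^ suc c + d ^ suc (suc c)         ≡⟨ regroup (d ^ suc c) c (d ^ c) d ⟩
    d ^ suc c + d * (suc c * d ^ c + d ^ suc c)       ≤⟨ +-mono-≤ (^-monoˡ-≤ (suc c) (n≤1+n d)) (*-monoʳ-≤ d (power-gap d c)) ⟩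
    suc d ^ suc (suc c)                               ∎
    where
    open ≤-Reasoning
    regroup : ∀ p c x d → suc (suc c) * (d * x) + d * (d * x) ≡ d * x + d * (suc c * x + d * x)
    regroup = solve-∀

  module Growth
    (N : ℕ → ℕ) (Q B μ j l d : ℕ)
    (step : ∀ k → Q * N k ≤ N (suc k) + (k C j) * (B * N (k ∸ j)))
    (B≤ : B ≤ μ * Q ^ j)
    (column≤ : ∀ r → r + suc j ≤ l → column j r (suc j) ≤ suc d)
    (small : μ * suc (suc d) ^ suc d ≤ Q * suc d ^ d)
    where

    private
      D = suc d

      Grows : ℕ → Set
      Grows k = Q * D ^ (k C j) * N k ≤ suc D ^ (k C j) * N (suc k)

      small′ : ∀ s → s ≤ d → μ * suc D ^ suc s ≤ Q * D ^ s
      small′ s s≤d = *-cancelʳ-≤ _ _ (D ^ (d ∸ s)) {{m^n≢0 D (d ∸ s)}} (begin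
        μ * suc D ^ suc s * D ^ (d ∸ s)        ≤⟨ *-monoʳ-≤ (μ * suc D ^ suc s) (^-monoˡ-≤ (d ∸ s) (n≤1+n D)) ⟩
        μ * suc D ^ suc s * suc D ^ (d ∸ s)    ≡⟨ *-assoc μ _ _ ⟩
        μ * (suc D ^ suc s * suc D ^ (d ∸ s))  ≡⟨ cong (μ *_) (^-distribˡ-+-* (suc D) (suc s) (d ∸ s)) ⟨
        μ * suc D ^ (suc s + (d ∸ s))          ≡⟨ cong (λ x → μ * suc D ^ suc x) (m+[n∸m]≡n s≤d) ⟩
        μ * suc D ^ D                          ≤⟨ small ⟩
        Q * D ^ d                              ≡⟨ cong (λ x → Q * D ^ x) (m+[n∸m]≡n s≤d) ⟨
        Q * D ^ (s + (d ∸ s))                  ≡⟨ cong (Q *_) (^-distribˡ-+-* D s (d ∸ s)) ⟩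
        Q * (D ^ s * D ^ (d ∸ s))              ≡⟨ *-assoc Q _ _ ⟨
        Q * D ^ s * D ^ (d ∸ s)                ∎)
        where open ≤-Reasoning

      chain : ∀ r i → (∀ k → k < i + r → Grows k) →
              Q ^ i * D ^ column j r i * N r ≤ suc D ^ column j r i * N (i + r)
      chain r zero    _     = ≤-refl
      chain r (suc i) grows = begin
        Q * Q ^ i * D ^ (s + c) * N r
          ≡⟨ cong (λ x → Q * Q ^ i * x * N r) (^-distribˡ-+-* D s c) ⟩
        Q * Q ^ i * (D ^ s * D ^ c) * N r
          ≡⟨ eq₁ Q (Q ^ i) (D ^ s) (D ^ c) (N r) ⟩
        Q * D ^ c * (Q ^ i * D ^ s * N r)
          ≤⟨ *-monoʳ-≤ (Q * D ^ c) (chain r i (λ k k< → grows k (m<n⇒m<1+n k<))) ⟩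
        Q * D ^ c * (suc D ^ s * N (i + r))
          ≡⟨ eq₂ (Q * D ^ c) (suc D ^ s) (N (i + r)) ⟩
        suc D ^ s * (Q * D ^ c * N (i + r))
          ≤⟨ *-monoʳ-≤ (suc D ^ s) (grows (i + r) ≤-refl) ⟩
        suc D ^ s * (suc D ^ c * N (suc i + r))
          ≡⟨ *-assoc (suc D ^ s) (suc D ^ c) _ ⟨
        suc D ^ s * suc D ^ c * N (suc i + r)
          ≡⟨ cong (_* N (suc i + r)) (^-distribˡ-+-* (suc D) s c) ⟨
        suc D ^ (s + c) * N (suc i + r) ∎
        where
        open ≤-Reasoning
        s = column j r i
        c = (i + r) C j
        eq₁ : ∀ a b c d e → a * b * (c * d) * e ≡ a * d * (b * c * e)
        eq₁ = solve-∀
        eq₂ : ∀ a b c → a * (b * c) ≡ b * (a * c)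
        eq₂ = solve-∀

      extend : ∀ c s X Y X′ → Q * X ≤ X′ + suc c * (B * Y) →
               Q ^ j * D ^ s * Y ≤ suc D ^ s * X → s + suc c ≤ D →
               Q * D ^ suc c * X ≤ suc D ^ suc c * X′
      extend c s X Y X′ X→X′ Y→X s+1+c≤D = +-cancelʳ-≤ (suc c * (Q * D ^ c * X)) _ _ (begin
        Q * (D * D ^ c) * X + suc c * (Q * D ^ c * X)
          ≡⟨ eq₁ Q (D * D ^ c) X (suc c) (D ^ c) ⟩
        (suc c * D ^ c + D ^ suc c) * (Q * X)
          ≤⟨ *-monoˡ-≤ (Q * X) (power-gap D c) ⟩
        b * (Q * X)
          ≤⟨ *-monoʳ-≤ b X→X′ ⟩
        b * (X′ + suc c * (B * Y))
          ≡⟨ eq₂ b X′ (suc c) B Y ⟩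
        b * X′ + suc c * (b * B * Y)
          ≤⟨ +-monoʳ-≤ (b * X′) (*-monoʳ-≤ (suc c) zeros≤) ⟩
        b * X′ + suc c * (Q * D ^ c * X) ∎)
        where
        open ≤-Reasoning
        b = suc D ^ suc c
        eq₁ : ∀ q e x c p → q * e * x + c * (q * p * x) ≡ (c * p + e) * (q * x)
        eq₁ = solve-∀
        eq₂ : ∀ b x c z y → b * (x + c * (z * y)) ≡ b * x + c * (b * z * y)
        eq₂ = solve-∀
        eq₃ : ∀ b μ q y p → b * (μ * q) * y * p ≡ b * μ * (q * p * y)
        eq₃ = solve-∀
        eq₄ : ∀ b μ p x → b * μ * (p * x) ≡ μ * (b * p) * x
        eq₄ = solve-∀
        eq₅ : ∀ q p r x → q * (p * r) * x ≡ q * p * x * r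
        eq₅ = solve-∀
        zeros≤ : b * B * Y ≤ Q * D ^ c * X
        zeros≤ = *-cancelʳ-≤ _ _ (D ^ s) {{m^n≢0 D s}} (begin
          b * B * Y * D ^ s                ≤⟨ *-monoˡ-≤ (D ^ s) (*-monoˡ-≤ Y (*-monoʳ-≤ b B≤)) ⟩
          b * (μ * Q ^ j) * Y * D ^ s      ≡⟨ eq₃ b μ (Q ^ j) Y (D ^ s) ⟩
          b * μ * (Q ^ j * D ^ s * Y)      ≤⟨ *-monoʳ-≤ (b * μ) Y→X ⟩
          b * μ * (suc D ^ s * X)          ≡⟨ eq₄ b μ (suc D ^ s) X ⟩
          μ * (b * suc D ^ s) * X          ≡⟨ cong (λ e → μ * e * X) (^-distribˡ-+-* (suc D) (suc c) s) ⟨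
          μ * suc D ^ suc (c + s) * X      ≤⟨ *-monoˡ-≤ X (small′ (c + s) c+s≤d) ⟩
          Q * D ^ (c + s) * X              ≡⟨ cong (λ e → Q * e * X) (^-distribˡ-+-* D c s) ⟩
          Q * (D ^ c * D ^ s) * X          ≡⟨ eq₅ Q (D ^ c) (D ^ s) X ⟩
          Q * D ^ c * X * D ^ s            ∎)
          where
          c+s≤d : c + s ≤ d
          c+s≤d = ℕ.s≤s⁻¹ (subst (_≤ D) (trans (+-suc s c) (cong suc (+-comm s c))) s+1+c≤D)

      grows : ∀ k → k < l → Grows k
      grows = <-rec (λ k → k < l → Grows k) go
        where
        go : ∀ k → (∀ {k′} → k′ < k → k′ < l → Grows k′) → k < l → Grows k
        go k rec k<l = byCases (k C j) refl
          where
          r = k ∸ j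
          byCases : ∀ c → k C j ≡ c → Q * D ^ c * N k ≤ suc D ^ c * N (suc k)
          byCases zero eq = subst₂ _≤_ (cong (_* N k) (sym (*-identityʳ Q)))
            (cong (λ c → N (suc k) + c * (B * N r)) eq) (step k)
          byCases (suc c) eq = extend c (column j r j) (N k) (N r) (N (suc k))
            (subst (λ c → Q * N k ≤ N (suc k) + c * (B * N r)) eq (step k))
            (subst (λ x → Q ^ j * D ^ column j r j * N r ≤ suc D ^ column j r j * N x) j+r≡k
              (chain r j λ k′ k′<j+r → let k′<k = subst (k′ <_) j+r≡k k′<j+r in rec k′<k (<-trans k′<k k<l)))
            (subst (λ x → column j r j + x ≤ D) (trans (cong (_C j) j+r≡k) eq)
              (column≤ r (subst (_≤ l) (sym (trans (+-suc r j) (cong suc (trans (+-comm r j) j+r≡k)))) k<l)))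
            where
            j≤k : j ≤ k
            j≤k = ≮⇒≥ λ k<j → 0≢1+n (trans (sym (k>n⇒nCk≡0 k<j)) eq)
            j+r≡k : j + r ≡ k
            j+r≡k = m+[n∸m]≡n j≤k

    positive : .{{NonZero Q}} → N 0 ≡ 1 → 0 < N l
    positive N0≡1 = n≢0⇒n>0 λ Nl≡0 → n≮0 (begin-strict
      0                                       <⟨ *-mono-< (m^n>0 Q l) (m^n>0 D (column j 0 l)) ⟩
      Q ^ l * D ^ column j 0 l                ≡⟨ *-identityʳ _ ⟨
      Q ^ l * D ^ column j 0 l * 1            ≡⟨ cong (Q ^ l * D ^ column j 0 l *_) N0≡1 ⟨
      Q ^ l * D ^ column j 0 l * N 0          ≤⟨ chain 0 l (λ k k< → grows k (subst (k <_) (+-identityʳ l) k<)) ⟩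
      suc D ^ column j 0 l * N (l + 0)        ≡⟨ cong (λ x → suc D ^ column j 0 l * N x) (+-identityʳ l) ⟩
      suc D ^ column j 0 l * N l              ≡⟨ cong (suc D ^ column j 0 l *_) Nl≡0 ⟩
      suc D ^ column j 0 l * 0                ≡⟨ *-zeroʳ (suc D ^ column j 0 l) ⟩
      0 ∎)
      where open ≤-Reasoning

  -- truncatedBinomial D n K = D^K Σ_{k≤K} C(n,k) D^{-k}
  truncatedBinomial : (D n K : ℕ) → ℕ
  truncatedBinomial D n zero    = 1
  truncatedBinomial D n (suc K) = D * truncatedBinomial D n K + n C suc K

  truncatedBinomial-Pascal : ∀ D n K → truncatedBinomial D (suc n) (suc K) ≡
    truncatedBinomial D n (suc K) + truncatedBinomial D n K
  truncatedBinomial-Pascal D n zero = begin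
    D * 1 + suc n C 1          ≡⟨ cong (λ x → D * 1 + x) (nCk+nC[k+1]≡[n+1]C[k+1] n 0) ⟨
    D * 1 + (n C 0 + n C 1)    ≡⟨ cong (λ x → D * 1 + (x + n C 1)) (nC0≡1 n) ⟩
    D * 1 + (1 + n C 1)        ≡⟨ eq D (n C 1) ⟩
    D * 1 + n C 1 + 1          ∎
    where
    open ≡.≡-Reasoning
    eq : ∀ D x → D * 1 + (1 + x) ≡ D * 1 + x + 1
    eq = solve-∀
  truncatedBinomial-Pascal D n (suc K) = begin
    D * T (suc n) (suc K) + suc n C suc (suc K)
      ≡⟨ cong₂ (λ x y → D * x + y) (truncatedBinomial-Pascal D n K) (sym (nCk+nC[k+1]≡[n+1]C[k+1] n (suc K))) ⟩
    D * (T n (suc K) + T n K) + (n C suc K + n C suc (suc K))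
      ≡⟨ eq D (T n (suc K)) (T n K) (n C suc K) (n C suc (suc K)) ⟩
    D * T n (suc K) + n C suc (suc K) + (D * T n K + n C suc K) ∎
    where
    open ≡.≡-Reasoning
    T = truncatedBinomial D
    eq : ∀ D a b x y → D * (a + b) + (x + y) ≡ D * a + y + (D * b + x)
    eq = solve-∀

  binomial : ∀ D n i → truncatedBinomial D n (n + i) ≡ D ^ i * suc D ^ n
  binomial D zero zero    = refl
  binomial D zero (suc i) = trans (+-identityʳ _)
    (trans (cong (D *_) (binomial D zero i)) (sym (*-assoc D (D ^ i) 1)))
  binomial D (suc n) i = begin
    T (suc n) (suc (n + i))                  ≡⟨ truncatedBinomial-Pascal D n (n + i) ⟩
    T n (suc (n + i)) + T n (n + i)          ≡⟨ cong (λ x → T n x + T n (n + i)) (+-suc n i) ⟨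
    T n (n + suc i) + T n (n + i)            ≡⟨ cong₂ _+_ (binomial D n (suc i)) (binomial D n i) ⟩
    D * D ^ i * suc D ^ n + D ^ i * suc D ^ n ≡⟨ eq D (D ^ i) (suc D ^ n) ⟩
    D ^ i * (suc D * suc D ^ n)              ∎
    where
    open ≡.≡-Reasoning
    T = truncatedBinomial D
    eq : ∀ D p x → D * p * x + p * x ≡ p * (suc D * x)
    eq = solve-∀

  -- scaledExpSum K = Σ_{k≤K} K!/k!
  scaledExpSum : ℕ → ℕ
  scaledExpSum zero    = 1
  scaledExpSum (suc K) = suc K * scaledExpSum K + 1

  C-!≤^ : ∀ n k → (n C k) * k ! ≤ n ^ k
  C-!≤^ n       zero    rewrite nC0≡1 n = ≤-refl
  C-!≤^ zero    (suc k) = z≤n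
  C-!≤^ (suc n) (suc k) = begin
    (suc n C suc k) * suc k !                         ≡⟨ cong (_* suc k !) (nCk+nC[k+1]≡[n+1]C[k+1] n k) ⟨
    (n C k + n C suc k) * (suc k * k !)               ≡⟨ eq (n C k) (n C suc k) (suc k) (k !) ⟩
    suc k * ((n C k) * k !) + (n C suc k) * suc k !   ≤⟨ +-mono-≤ (*-monoʳ-≤ (suc k) (C-!≤^ n k)) (C-!≤^ n (suc k)) ⟩
    suc k * n ^ k + n ^ suc k                         ≤⟨ power-gap n k ⟩
    suc n ^ suc k                                     ∎
    where
    open ≤-Reasoning
    eq : ∀ a b k f → (a + b) * (k * f) ≡ k * (a * f) + b * (k * f)
    eq = solve-∀

  truncatedBinomial≤ : ∀ D K → truncatedBinomial D D K * K ! ≤ D ^ K * scaledExpSum K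
  truncatedBinomial≤ D zero    = ≤-refl
  truncatedBinomial≤ D (suc K) = begin
    (D * T + D C suc K) * suc K !                     ≡⟨ eq₁ D T (D C suc K) (suc K) (K !) ⟩
    D * suc K * (T * K !) + (D C suc K) * suc K !     ≤⟨ +-mono-≤ (*-monoʳ-≤ (D * suc K) (truncatedBinomial≤ D K)) (C-!≤^ D (suc K)) ⟩
    D * suc K * (D ^ K * scaledExpSum K) + D ^ suc K  ≡⟨ eq₂ D (suc K) (D ^ K) (scaledExpSum K) ⟩
    D ^ suc K * scaledExpSum (suc K)                  ∎
    where
    open ≤-Reasoning
    T = truncatedBinomial D D K
    eq₁ : ∀ D t c k f → (D * t + c) * (k * f) ≡ D * k * (t * f) + c * (k * f)
    eq₁ = solve-∀
    eq₂ : ∀ D k p s → D * k * (p * s) + D * p ≡ D * p * (k * s + 1)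
    eq₂ = solve-∀

  [1+1/D]^D≤expSum : ∀ D → suc D ^ D * D ! ≤ D ^ D * scaledExpSum D
  [1+1/D]^D≤expSum D = subst (λ x → x * D ! ≤ D ^ D * scaledExpSum D)
    (trans (cong (truncatedBinomial D D) (sym (+-identityʳ D)))
           (trans (binomial D D 0) (*-identityˡ (suc D ^ D))))
    (truncatedBinomial≤ D D)

  e≤⇒small : ∀ d μ Q → scaledExpSum (suc d) * (suc d * μ) ≤ suc d ! * Q →
             μ * suc (suc d) ^ suc d ≤ Q * suc d ^ d
  e≤⇒small d μ Q e≤ = *-cancelˡ-≤ (D * D !) {{m*n≢0 D (D !) {{_}} {{D !≢0}}}} (begin
    D * D ! * (μ * suc D ^ D)                    ≡⟨ eq₁ D (D !) μ (suc D ^ D) ⟩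
    suc D ^ D * D ! * (D * μ)                    ≤⟨ *-monoˡ-≤ (D * μ) ([1+1/D]^D≤expSum D) ⟩
    D ^ D * scaledExpSum D * (D * μ)             ≡⟨ *-assoc (D ^ D) _ _ ⟩
    D ^ D * (scaledExpSum D * (D * μ))           ≤⟨ *-monoʳ-≤ (D ^ D) e≤ ⟩
    D ^ D * (D ! * Q)                            ≡⟨ eq₂ D (D ^ d) (D !) Q ⟩
    D * D ! * (Q * D ^ d)                        ∎)
    where
    open ≤-Reasoning
    D = suc d
    eq₁ : ∀ D f μ p → D * f * (μ * p) ≡ p * f * (D * μ)
    eq₁ = solve-∀
    eq₂ : ∀ D p f q → D * p * (f * q) ≡ D * f * (q * p)
    eq₂ = solve-∀

  ≤+ε⇒≤ : ∀ {x y} → (∀ ε → 0ℚ ℚ.< ε → x ℚ.≤ y ℚ.+ ε) → x ℚ.≤ y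
  ≤+ε⇒≤ {x} {y} x≤y+ε = ℚ.≮⇒≥ λ y<x →
    let z , y<z , z<x = ℚ.<-dense y<x
        0<z-y = subst (ℚ._< z ℚ.- y) (ℚ.+-inverseʳ y) (ℚ.+-monoˡ-< (ℚ.- y) y<z)
        x≤z = subst (x ℚ.≤_) (solve 2 (λ y z → y :+ (z :- y) := z) refl y z) (x≤y+ε (z ℚ.- y) 0<z-y)
    in  ℚ.<-irrefl refl (ℚ.<-≤-trans z<x x≤z)
    where open +-*-Solver

  expSum-mono : ∀ {i j} → i ℕ.≤′ j → expSum i ℚ.≤ expSum j
  expSum-mono ℕ.≤′-refl = ℚ.≤-refl
  expSum-mono (ℕ.≤′-step {j} i≤j) = ℚ.≤-trans (expSum-mono i≤j)
    (subst (ℚ._≤ expSum (suc j)) (ℚ.+-identityʳ (expSum j))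
      (ℚ.+-monoʳ-≤ (expSum j) (ℚ.nonNegative⁻¹ _ {{ℚ.normalize-nonNeg 1 (suc j !) {{suc j !≢0}}}})))

  expSum≤ : ∀ r → ℚ.NonNegative r → e ·ᵣ r ≤ᵣ fromℚ 1ℚ → ∀ i → expSum i ℚ.* r ℚ.≤ 1ℚ
  expSum≤ r r≥0 er≤1 i = ≤+ε⇒≤ λ ε 0<ε →
    let N , bound = er≤1 ε 0<ε
    in  ℚ.≤-trans (ℚ.*-monoʳ-≤-nonNeg r {{r≥0}} (expSum-mono (≤⇒≤′ (m≤m+n i N))))
                  (bound (i + N) (m≤n+m N i))

  ι : ℕ → ℚ
  ι a = + a / 1

  private
    toℚᵘ-/ : ∀ i n .{{_ : NonZero n}} → ℚ.toℚᵘ (i / n) ℚᵘ.≃ (i ℚᵘ./ n)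
    toℚᵘ-/ i (suc n) = ℚ.toℚᵘ-fromℚᵘ (ℚᵘ.mkℚᵘ i n)

  ι-+ : ∀ a b → ι (a + b) ≡ ι a ℚ.+ ι b
  ι-+ a b = ℚ.toℚᵘ-injective (begin
    ℚ.toℚᵘ (ι (a + b))               ≈⟨ toℚᵘ-/ (+ (a + b)) 1 ⟩
    + (a + b) ℚᵘ./ 1                 ≈⟨ ℚᵘ.*≡* (cong (ℤ._* + 1) (sym (cong₂ ℤ._+_ (ℤ.*-identityʳ (+ a)) (ℤ.*-identityʳ (+ b))))) ⟩
    (+ a ℚᵘ./ 1) ℚᵘ.+ (+ b ℚᵘ./ 1)   ≈⟨ ℚᵘ.+-cong (toℚᵘ-/ (+ a) 1) (toℚᵘ-/ (+ b) 1) ⟨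
    ℚ.toℚᵘ (ι a) ℚᵘ.+ ℚ.toℚᵘ (ι b)   ≈⟨ ℚ.toℚᵘ-homo-+ (ι a) (ι b) ⟨
    ℚ.toℚᵘ (ι a ℚ.+ ι b)             ∎)
    where open ℚᵘ.≃-Reasoning

  ι-*-/ : ∀ a b c .{{_ : NonZero c}} → ι a ℚ.* (+ b / c) ≡ + (a * b) / c
  ι-*-/ a b c@(suc _) = ℚ.toℚᵘ-injective (begin
    ℚ.toℚᵘ (ι a ℚ.* (+ b / c))           ≈⟨ ℚ.toℚᵘ-homo-* (ι a) (+ b / c) ⟩
    ℚ.toℚᵘ (ι a) ℚᵘ.* ℚ.toℚᵘ (+ b / c)   ≈⟨ ℚᵘ.*-cong (toℚᵘ-/ (+ a) 1) (toℚᵘ-/ (+ b) c) ⟩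
    (+ a ℚᵘ./ 1) ℚᵘ.* (+ b ℚᵘ./ c)       ≈⟨ ℚᵘ.*≡* (cong₂ ℤ._*_ (sym (ℤ.pos-* a b)) (cong +_ (sym (*-identityˡ c)))) ⟩
    + (a * b) ℚᵘ./ c                     ≈⟨ toℚᵘ-/ (+ (a * b)) c ⟨
    ℚ.toℚᵘ (+ (a * b) / c)               ∎)
    where open ℚᵘ.≃-Reasoning

  n*m/n≡ι : ∀ m n .{{_ : NonZero n}} → + (n * m) / n ≡ ι m
  n*m/n≡ι m n@(suc _) = ℚ.toℚᵘ-injective (begin
    ℚ.toℚᵘ (+ (n * m) / n)   ≈⟨ toℚᵘ-/ (+ (n * m)) n ⟩
    + (n * m) ℚᵘ./ n         ≈⟨ ℚᵘ.*≡* (trans (sym (ℤ.pos-* (n * m) 1)) (trans (cong +_ (trans (*-identityʳ (n * m)) (*-comm n m))) (ℤ.pos-* m n))) ⟩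
    + m ℚᵘ./ 1               ≈⟨ toℚᵘ-/ (+ m) 1 ⟨
    ℚ.toℚᵘ (ι m)             ∎)
    where open ℚᵘ.≃-Reasoning

  ι-* : ∀ a b → ι (a * b) ≡ ι a ℚ.* ι b
  ι-* a b = sym (ι-*-/ a b 1)

  ι-cancel : ∀ m n .{{_ : NonZero n}} → ι n ℚ.* (+ m / n) ≡ ι m
  ι-cancel m n = trans (ι-*-/ n m n) (n*m/n≡ι m n)

  ι-^ : ∀ m q .{{_ : NonZero q}} n → ι (q ^ n) ℚ.* (+ m / q) ^ℚ n ≡ ι (m ^ n)
  ι-^ m q zero    = refl
  ι-^ m q (suc n) = begin
    ι (q * q ^ n) ℚ.* (x ℚ.* x ^ℚ n)          ≡⟨ cong (ℚ._* (x ℚ.* x ^ℚ n)) (ι-* q (q ^ n)) ⟩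
    ι q ℚ.* ι (q ^ n) ℚ.* (x ℚ.* x ^ℚ n)      ≡⟨ solve 4 (λ a b c d → a :* b :* (c :* d) := a :* c :* (b :* d)) refl (ι q) (ι (q ^ n)) x (x ^ℚ n) ⟩
    ι q ℚ.* x ℚ.* (ι (q ^ n) ℚ.* x ^ℚ n)      ≡⟨ cong₂ ℚ._*_ (ι-cancel m q) (ι-^ m q n) ⟩
    ι m ℚ.* ι (m ^ n)                         ≡⟨ ι-* m (m ^ n) ⟨
    ι (m * m ^ n)                             ∎
    where
    open ≡.≡-Reasoning
    open +-*-Solver
    x = + m / q

  ι-expSum : ∀ K → ι (K !) ℚ.* expSum K ≡ ι (scaledExpSum K)
  ι-expSum zero    = refl
  ι-expSum (suc K) = begin
    ι (suc K !) ℚ.* (expSum K ℚ.+ (1/ suc K !))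
      ≡⟨ ℚ.*-distribˡ-+ (ι (suc K !)) (expSum K) (1/ suc K !) ⟩
    ι (suc K !) ℚ.* expSum K ℚ.+ ι (suc K !) ℚ.* (1/ suc K !)
      ≡⟨ cong₂ (λ x y → x ℚ.* expSum K ℚ.+ y) (ι-* (suc K) (K !)) (ι-cancel 1 (suc K !) {{suc K !≢0}}) ⟩
    ι (suc K) ℚ.* ι (K !) ℚ.* expSum K ℚ.+ ι 1
      ≡⟨ cong (ℚ._+ ι 1) (trans (ℚ.*-assoc (ι (suc K)) (ι (K !)) (expSum K)) (cong (ι (suc K) ℚ.*_) (ι-expSum K))) ⟩
    ι (suc K) ℚ.* ι (scaledExpSum K) ℚ.+ ι 1
      ≡⟨ cong (ℚ._+ ι 1) (ι-* (suc K) (scaledExpSum K)) ⟨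
    ι (suc K * scaledExpSum K) ℚ.+ ι 1
      ≡⟨ ι-+ (suc K * scaledExpSum K) 1 ⟨
    ι (suc K * scaledExpSum K + 1) ∎
    where open ≡.≡-Reasoning

  ι-cancel-≤ : ∀ {a b} → ι a ℚ.≤ ι b → a ≤ b
  ι-cancel-≤ {a} {b} ιa≤ιb
    with ℚᵘ.*≤* a*1≤b*1 ← ℚᵘ.≤-respˡ-≃ (toℚᵘ-/ (+ a) 1) (ℚᵘ.≤-respʳ-≃ (toℚᵘ-/ (+ b) 1) (ℚ.toℚᵘ-mono-≤ ιa≤ιb))
    = ℤ.drop‿+≤+ (subst₂ ℤ._≤_ (ℤ.*-identityʳ (+ a)) (ℤ.*-identityʳ (+ b)) a*1≤b*1)

  clearDenominators : ∀ D m q .{{_ : NonZero q}} n →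
    e ·ᵣ (ι D ℚ.* (+ m / q) ^ℚ n) ≤ᵣ fromℚ 1ℚ →
    ∀ K → scaledExpSum K * (D * m ^ n) ≤ K ! * q ^ n
  clearDenominators D m q n er≤1 K = ι-cancel-≤ (subst₂ ℚ._≤_ lhs rhs
    (ℚ.*-monoˡ-≤-nonNeg (ι (K ! * q ^ n)) {{ℚ.normalize-nonNeg (K ! * q ^ n) 1}}
      (expSum≤ r r≥0 er≤1 K)))
    where
    open ≡.≡-Reasoning
    open +-*-Solver
    r = ι D ℚ.* (+ m / q) ^ℚ n
    ^-nonNeg : ∀ n → ℚ.NonNegative ((+ m / q) ^ℚ n)
    ^-nonNeg zero    = _
    ^-nonNeg (suc n) = ℚ.nonNeg*nonNeg⇒nonNeg (+ m / q) {{ℚ.normalize-nonNeg m q}} _ {{^-nonNeg n}}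
    r≥0 : ℚ.NonNegative r
    r≥0 = ℚ.nonNeg*nonNeg⇒nonNeg (ι D) {{ℚ.normalize-nonNeg D 1}} _ {{^-nonNeg n}}
    lhs : ι (K ! * q ^ n) ℚ.* (expSum K ℚ.* r) ≡ ι (scaledExpSum K * (D * m ^ n))
    lhs = begin
      ι (K ! * q ^ n) ℚ.* (expSum K ℚ.* r)
        ≡⟨ cong (ℚ._* (expSum K ℚ.* r)) (ι-* (K !) (q ^ n)) ⟩
      ι (K !) ℚ.* ι (q ^ n) ℚ.* (expSum K ℚ.* r)
        ≡⟨ solve 5 (λ a b c d f → a :* b :* (c :* (d :* f)) := a :* c :* (d :* (b :* f))) refl
             (ι (K !)) (ι (q ^ n)) (expSum K) (ι D) ((+ m / q) ^ℚ n) ⟩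
      ι (K !) ℚ.* expSum K ℚ.* (ι D ℚ.* (ι (q ^ n) ℚ.* (+ m / q) ^ℚ n))
        ≡⟨ cong₂ (λ x y → x ℚ.* (ι D ℚ.* y)) (ι-expSum K) (ι-^ m q n) ⟩
      ι (scaledExpSum K) ℚ.* (ι D ℚ.* ι (m ^ n))
        ≡⟨ cong (ι (scaledExpSum K) ℚ.*_) (ι-* D (m ^ n)) ⟨
      ι (scaledExpSum K) ℚ.* ι (D * m ^ n)
        ≡⟨ ι-* (scaledExpSum K) (D * m ^ n) ⟨
      ι (scaledExpSum K * (D * m ^ n)) ∎
    rhs : ι (K ! * q ^ n) ℚ.* 1ℚ ≡ ι (K ! * q ^ n)
    rhs = ℚ.*-identityʳ _

open ExponentialBound

⟦⟧-no : (d : Dec A) → ¬ A → ⟦ d ⟧ ≡ 0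
⟦⟧-no (yes y) ¬y = contradiction y ¬y
⟦⟧-no (no _)  _  = refl

⟦⟧-× : (x? : Dec A) (y? : Dec B) (z? : Dec W) → (A → B) → (A → W) → ⟦ x? ⟧ ≤ ⟦ y? ⟧ ℕ.* ⟦ z? ⟧
⟦⟧-× (no _)  y?      z?      _   _   = z≤n
⟦⟧-× (yes x) (yes y) (yes z) _   _   = ≤-refl
⟦⟧-× (yes x) (yes y) (no ¬z) _   x⇒z = contradiction (x⇒z x) ¬z
⟦⟧-× (yes x) (no ¬y) z?      x⇒y _   = contradiction (x⇒y x) ¬y

∑-atMostOne : {P : Pred A ℓx} {_~_ : A → A → Set ℓy} (P? : Decidable P) →
  (∀ {x y} → P x → P y → x ~ y) → ∀ {xs} → AllPairs (λ x y → ¬ (x ~ y)) xs →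
  ∑ xs (λ x → ⟦ P? x ⟧) ≤ 1
∑-atMostOne P? P⇒~ [] = z≤n
∑-atMostOne {P = P} P? P⇒~ (_∷_ {x = x} x≁xs xs!) with P? x
... | no _  = ∑-atMostOne P? P⇒~ xs!
... | yes p = s≤s (none x≁xs)
  where
  none : ∀ {ys} → All (λ y → ¬ _) ys → ∑ ys (λ y → ⟦ P? y ⟧) ≤ 0
  none []           = z≤n
  none (_∷_ {x = y} x≁y x≁ys) rewrite ⟦⟧-no (P? y) (x≁y ∘ P⇒~ p) = none x≁ys

∑-words-cartesianProductWith : ∀ k (f : A → B → W) xs ys (h : List W → ℕ) →
  ∑ (words k (cartesianProductWith f xs ys)) h ≡
  ∑ (words k xs) (λ u → ∑ (words k ys) (λ v → h (zipWith f u v)))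
∑-words-cartesianProductWith zero f xs ys h = ≡.sym (ℕ.+-identityʳ _)
∑-words-cartesianProductWith (suc k) f xs ys h = begin
  ∑ (words (suc k) xys) h
    ≡⟨ ∑-words-suc k xys h ⟩
  ∑ xys (λ z → ∑ (words k xys) (λ w → h (z ∷ w)))
    ≡⟨ ∑-cartesianProductWith f xs ys _ ⟩
  ∑ xs (λ x → ∑ ys (λ y → ∑ (words k xys) (λ w → h (f x y ∷ w))))
    ≡⟨ ∑-cong xs (λ x → ∑-cong ys (λ y → ∑-words-cartesianProductWith k f xs ys _)) ⟩
  ∑ xs (λ x → ∑ ys (λ y → ∑ (words k xs) (λ u → ∑ (words k ys) (λ v → h (f x y ∷ zipWith f u v)))))
    ≡⟨ ∑-cong xs (λ x → ∑-swap ys (words k xs) _) ⟩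
  ∑ xs (λ x → ∑ (words k xs) (λ u → ∑ ys (λ y → ∑ (words k ys) (λ v → h (f x y ∷ zipWith f u v)))))
    ≡⟨ ∑-cong xs (λ x → ∑-cong (words k xs) (λ u → ≡.sym (∑-words-suc k ys _))) ⟩
  ∑ xs (λ x → ∑ (words k xs) (λ u → ∑ (words (suc k) ys) (λ v → h (zipWith f (x ∷ u) v))))
    ≡⟨ ∑-words-suc k xs _ ⟨
  ∑ (words (suc k) xs) (λ u → ∑ (words (suc k) ys) (λ v → h (zipWith f u v))) ∎
  where
  open ≡.≡-Reasoning
  xys = cartesianProductWith f xs ys

length-cartesianProductWith : ∀ (f : A → B → W) xs ys →
  length (cartesianProductWith f xs ys) ≡ length xs ℕ.* length ys
length-cartesianProductWith f []       ys = refl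
length-cartesianProductWith f (x ∷ xs) ys = ≡.trans (length-++ (map (f x) ys))
  (cong₂ ℕ._+_ (length-map (f x) ys) (length-cartesianProductWith f xs ys))

combinations-map : ∀ (f : A → B) m xs → combinations m (map f xs) ≡ map (map f) (combinations m xs)
combinations-map f zero    xs       = refl
combinations-map f (suc m) []       = refl
combinations-map f (suc m) (x ∷ xs) = begin
  map (f x ∷_) (combinations m (map f xs)) ++ combinations (suc m) (map f xs)
    ≡⟨ cong₂ (λ c d → map (f x ∷_) c ++ d) (combinations-map f m xs) (combinations-map f (suc m) xs) ⟩
  map (f x ∷_) (map (map f) (combinations m xs)) ++ map (map f) (combinations (suc m) xs)
    ≡⟨ cong (_++ _) (≡.trans (≡.sym (map-∘ (combinations m xs))) (map-∘ (combinations m xs))) ⟩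
  map (map f) (map (x ∷_) (combinations m xs)) ++ map (map f) (combinations (suc m) xs)
    ≡⟨ map-++ (map f) (map (x ∷_) (combinations m xs)) _ ⟨
  map (map f) (combinations (suc m) (x ∷ xs)) ∎
  where open ≡.≡-Reasoning

module _ {c ℓ} (R : CommutativeRing c ℓ) where
  open CommutativeRing R hiding (refl)

  foldr-coordinate : ∀ {n} (_∙_ : Carrier → Carrier → Carrier) ε (fs : List (Fin n → Carrier)) i →
    foldr (λ f g i → f i ∙ g i) (λ _ → ε) fs i ≡ foldr _∙_ ε (map (λ f → f i) fs)
  foldr-coordinate _∙_ ε []       i = refl
  foldr-coordinate _∙_ ε (f ∷ fs) i = cong (f i ∙_) (foldr-coordinate _∙_ ε fs i)

  esym-coordinate : ∀ {n} m (gs : List (Fin n → Carrier)) i →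
    esym (R ^ᴿ n) m gs i ≡ esym R m (map (λ g → g i) gs)
  esym-coordinate {n} m gs i = begin
    esym (R ^ᴿ n) m gs i
      ≡⟨ foldr-coordinate _+_ 0# (map (product) (combinations m gs)) i ⟩
    foldr _+_ 0# (map (λ f → f i) (map (product) (combinations m gs)))
      ≡⟨ cong (foldr _+_ 0#) (map-∘ (combinations m gs)) ⟨
    foldr _+_ 0# (map (λ us → product us i) (combinations m gs))
      ≡⟨ cong (foldr _+_ 0#) (map-cong (λ us → foldr-coordinate _*_ 1# us i) (combinations m gs)) ⟩
    foldr _+_ 0# (map (λ us → foldr _*_ 1# (map (λ g → g i) us)) (combinations m gs))
      ≡⟨ cong (foldr _+_ 0#) (map-∘ (combinations m gs)) ⟩
    foldr _+_ 0# (map (foldr _*_ 1#) (map (map (λ g → g i)) (combinations m gs)))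
      ≡⟨ cong (foldr _+_ 0# ∘ map (foldr _*_ 1#)) (combinations-map (λ g → g i) m gs) ⟨
    esym R m (map (λ g → g i) gs) ∎
    where
    open ≡.≡-Reasoning
    module P = CommutativeRing (R ^ᴿ n)
    product : List P.Carrier → P.Carrier
    product = foldr P._*_ P.1#

  esym-∷ : ∀ m g gs → esym R (suc m) (g ∷ gs) ≈ g * esym R m gs + esym R (suc m) gs
  esym-∷ m g gs = go (combinations m gs)
    where
    open import Relation.Binary.Reasoning.Setoid setoid
    Σ : List (List Carrier) → Carrier
    Σ uss = foldr _+_ 0# (map (foldr _*_ 1#) uss)
    go : ∀ uss {vss} → Σ (map (g ∷_) uss ++ vss) ≈ g * Σ uss + Σ vss
    go [] {vss} = begin
      Σ vss              ≈⟨ +-identityˡ (Σ vss) ⟨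
      0# + Σ vss         ≈⟨ +-congʳ (zeroʳ g) ⟨
      g * 0# + Σ vss     ∎
    go (us ∷ uss) {vss} = begin
      g * p + Σ (map (g ∷_) uss ++ vss)   ≈⟨ +-congˡ (go uss) ⟩
      g * p + (g * Σ uss + Σ vss)         ≈⟨ +-assoc (g * p) (g * Σ uss) (Σ vss) ⟨
      g * p + g * Σ uss + Σ vss           ≈⟨ +-congʳ (distribˡ g p (Σ uss)) ⟨
      g * (p + Σ uss) + Σ vss             ∎
      where p = foldr _*_ 1# us

module FiniteFieldZeros {q c ℓ₁ ℓ₂} (F : FiniteField q c ℓ₁ ℓ₂) where
  open FiniteField F
  private module H = HeytingField heytingField
  open CommutativeRing commutativeRing hiding (refl)
  open Inverse enumeration using (to; from; inverseˡ; inverseʳ)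

  infix 4 _≈?_
  _≈?_ : ∀ x y → Dec (x ≈ y)
  x ≈? y = map′ (λ eq → trans (sym (inverseʳ ≡.refl)) (inverseʳ eq))
                (Inverse.to-cong enumeration) (to x Fin.≟ to y)

  elements : List Carrier
  elements = map from (allFin q)

  length-elements : length elements ≡ q
  length-elements = ≡.trans (length-map from (allFin q)) (length-tabulate {n = q} _)

  elements-unique : AllPairs (λ x y → ¬ x ≈ y) elements
  elements-unique = Unique.map⁺ (≡.setoid (Fin q)) setoid
    (λ eq → ≡.trans (≡.sym (inverseˡ H.refl)) (inverseˡ eq)) (UniqueP.allFin⁺ q)

  root-unique : ∀ {a b x y} → ¬ a ≈ 0# → x * a + b ≈ 0# → y * a + b ≈ 0# → x ≈ y
  root-unique {a} {b} {x} {y} a≉0 x-root y-root = proj₁ (H.tight x y) λ x#y →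
    let z , z[x-y]≈1 , _ = H.#⇒invertible x#y in
    a≉0 (begin
      a                   ≈⟨ *-identityˡ a ⟨
      1# * a              ≈⟨ *-congʳ z[x-y]≈1 ⟨
      z * (x - y) * a     ≈⟨ *-assoc z (x - y) a ⟩
      z * ((x - y) * a)   ≈⟨ *-congˡ [x-y]a≈0 ⟩
      z * 0#              ≈⟨ zeroʳ z ⟩
      0#                  ∎)
    where
    open import Relation.Binary.Reasoning.Setoid setoid
    open RingProperties ring
    [x-y]a≈0 : (x - y) * a ≈ 0#
    [x-y]a≈0 = begin
      (x - y) * a          ≈⟨ [y-z]x≈yx-zx a x y ⟩
      x * a - y * a        ≈⟨ +-congʳ (+-cancelʳ b (x * a) (y * a) (trans x-root (sym y-root))) ⟩
      y * a - y * a        ≈⟨ -‿inverseʳ (y * a) ⟩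
      0#                   ∎

  1≉0 : ¬ 1# ≈ 0#
  1≉0 1≈0 = proj₂ (H.tight 1# 0#) 1≈0 (H.invertible⇒#
    (1# , trans (*-identityˡ (1# - 0#)) 1-0≈1 , trans (*-identityʳ (1# - 0#)) 1-0≈1))
    where
    open RingProperties ring
    1-0≈1 : 1# - 0# ≈ 1#
    1-0≈1 = trans (+-congˡ -0#≈0#) (+-identityʳ 1#)

  #roots≤ : ∀ a b → ∑ elements (λ x → ⟦ x * a + b ≈? 0# ⟧) ≤ 1 ℕ.+ q ℕ.* ⟦ a ≈? 0# ⟧
  #roots≤ a b = byCases (a ≈? 0#)
    where
    open ℕ.≤-Reasoning
    byCases : (a? : Dec (a ≈ 0#)) → ∑ elements (λ x → ⟦ x * a + b ≈? 0# ⟧) ≤ 1 ℕ.+ q ℕ.* ⟦ a? ⟧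
    byCases (no a≉0) =
      ≤-trans (∑-atMostOne (λ x → x * a + b ≈? 0#) (root-unique a≉0) elements-unique) (ℕ.m≤m+n 1 _)
    byCases (yes _)  = begin
      ∑ elements (λ x → ⟦ x * a + b ≈? 0# ⟧)  ≤⟨ ∑-mono elements (λ x → ⟦⟧≤1 (x * a + b ≈? 0#)) ⟩
      ∑ elements (λ _ → 1)                    ≡⟨ ∑-const 1 elements ⟩
      length elements ℕ.* 1                   ≡⟨ cong (ℕ._* 1) length-elements ⟩
      q ℕ.* 1                                 ≤⟨ ℕ.n≤1+n _ ⟩
      1 ℕ.+ q ℕ.* 1                           ∎

  #esymZeros : ℕ → ℕ → ℕ
  #esymZeros m t = ∑ (words t elements) (λ u → ⟦ esym commutativeRing m u ≈? 0# ⟧)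

  #esymZeros≤ : ∀ m t → m ≤ t → #esymZeros m t ℕ.* q ≤ m ℕ.* q ^ t
  #esymZeros≤ zero    t       _         = ≤-reflexive (cong (ℕ._* q) (begin
    #esymZeros 0 t
      ≡⟨ ∑-cong (words t elements) (λ _ → ⟦⟧-no (1# + 0# ≈? 0#) λ eq → 1≉0 (trans (sym (+-identityʳ 1#)) eq)) ⟩
    ∑ (words t elements) (λ _ → 0)   ≡⟨ ∑-const 0 (words t elements) ⟩
    length (words t elements) ℕ.* 0  ≡⟨ ℕ.*-zeroʳ (length (words t elements)) ⟩
    0                                ∎))
    where open ≡.≡-Reasoning
  #esymZeros≤ (suc m) (suc t) (s≤s m≤t) = begin
    #esymZeros (suc m) (suc t) ℕ.* q
      ≡⟨ cong (ℕ._* q) (≡.trans (∑-words-suc t elements _) (∑-swap elements (words t elements) _)) ⟩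
    ∑ (words t elements) (λ u → ∑ elements (λ x → ⟦ esym commutativeRing (suc m) (x ∷ u) ≈? 0# ⟧)) ℕ.* q
      ≤⟨ ℕ.*-monoˡ-≤ q (∑-mono (words t elements) λ u → ≤-trans
           (∑-mono elements λ x → ⟦⟧-mono (esym commutativeRing (suc m) (x ∷ u) ≈? 0#) (_ ≈? 0#)
             (trans (sym (esym-∷ commutativeRing m x u))))
           (#roots≤ (esym commutativeRing m u) (esym commutativeRing (suc m) u))) ⟩
    ∑ (words t elements) (λ u → 1 ℕ.+ q ℕ.* ⟦ esym commutativeRing m u ≈? 0# ⟧) ℕ.* q
      ≡⟨ cong (ℕ._* q) (≡.trans (∑-+ (words t elements) _ _)
           (cong₂ ℕ._+_ (≡.trans (∑-words-const t elements) (cong (_^ t) length-elements))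
                        (∑-*ˡ q (words t elements) _))) ⟩
    (q ^ t ℕ.+ q ℕ.* #esymZeros m t) ℕ.* q
      ≡⟨ eq (q ^ t) q (#esymZeros m t) ⟩
    q ℕ.* q ^ t ℕ.+ q ℕ.* (#esymZeros m t ℕ.* q)
      ≤⟨ ℕ.+-monoʳ-≤ (q ^ suc t) (ℕ.*-monoʳ-≤ q (#esymZeros≤ m t m≤t)) ⟩
    q ℕ.* q ^ t ℕ.+ q ℕ.* (m ℕ.* q ^ t)
      ≡⟨ eq′ q (q ^ t) m ⟩
    suc m ℕ.* q ^ suc t ∎
    where
    open ℕ.≤-Reasoning
    eq : ∀ p q z → (p ℕ.+ q ℕ.* z) ℕ.* q ≡ q ℕ.* p ℕ.+ q ℕ.* (z ℕ.* q)
    eq = solve-∀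
    eq′ : ∀ q p m → q ℕ.* p ℕ.+ q ℕ.* (m ℕ.* p) ≡ suc m ℕ.* (q ℕ.* p)
    eq′ = solve-∀

  tuples : ∀ n → List (Fin n → Carrier)
  tuples zero    = Vector.[] ∷ []
  tuples (suc n) = cartesianProductWith Vector._∷_ elements (tuples n)

  length-tuples : ∀ n → length (tuples n) ≡ q ^ n
  length-tuples zero    = refl
  length-tuples (suc n) = ≡.trans (length-cartesianProductWith Vector._∷_ elements (tuples n))
    (cong₂ ℕ._*_ length-elements (length-tuples n))

  EsymZero : ∀ n → ℕ → Pred (List (Fin n → Carrier)) _
  EsymZero n m w = CommutativeRing._≈_ (commutativeRing ^ᴿ n) (esym (commutativeRing ^ᴿ n) m w)
                                                             (CommutativeRing.0# (commutativeRing ^ᴿ n))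

  esymZero? : ∀ n m → Decidable (EsymZero n m)
  esymZero? n m w = Fin.all? (λ i → esym (commutativeRing ^ᴿ n) m w i ≈? 0#)

  #esymZero-tuples≤ : ∀ n m t →
    ∑ (words t (tuples n)) (λ w → ⟦ esymZero? n m w ⟧) ≤ #esymZeros m t ^ n
  #esymZero-tuples≤ zero    m t = begin
    ∑ (words t (tuples 0)) (λ w → ⟦ esymZero? 0 m w ⟧)  ≤⟨ ∑-mono (words t (tuples 0)) (λ w → ⟦⟧≤1 (esymZero? 0 m w)) ⟩
    ∑ (words t (tuples 0)) (λ _ → 1)                    ≡⟨ ∑-words-const t (tuples 0) ⟩
    1 ^ t                                               ≡⟨ ℕ.^-zeroˡ t ⟩
    1                                                   ∎
    where open ℕ.≤-Reasoning
  #esymZero-tuples≤ (suc n) m t = begin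
    ∑ (words t (tuples (suc n))) (λ w → ⟦ esymZero? (suc n) m w ⟧)
      ≡⟨ ∑-words-cartesianProductWith t Vector._∷_ elements (tuples n) _ ⟩
    ∑ (words t elements) (λ u → ∑ (words t (tuples n)) (λ v → ⟦ esymZero? (suc n) m (zipWith Vector._∷_ u v) ⟧))
      ≤⟨ ∑-words-mono t elements (λ u ∣u∣≡t → ∑-words-mono t (tuples n) (λ v ∣v∣≡t →
           separate u v (≡.trans ∣u∣≡t (≡.sym ∣v∣≡t)))) ⟩
    ∑ (words t elements) (λ u → ∑ (words t (tuples n)) (λ v →
      ⟦ esym commutativeRing m u ≈? 0# ⟧ ℕ.* ⟦ esymZero? n m v ⟧))
      ≡⟨ ∑-cong (words t elements) (λ u → ∑-*ˡ ⟦ esym commutativeRing m u ≈? 0# ⟧ (words t (tuples n)) _) ⟩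
    ∑ (words t elements) (λ u → ⟦ esym commutativeRing m u ≈? 0# ⟧ ℕ.* rest)
      ≡⟨ ∑-*ʳ rest (words t elements) _ ⟩
    #esymZeros m t ℕ.* rest
      ≤⟨ ℕ.*-monoʳ-≤ (#esymZeros m t) (#esymZero-tuples≤ n m t) ⟩
    #esymZeros m t ^ suc n ∎
    where
    open ℕ.≤-Reasoning
    rest = ∑ (words t (tuples n)) (λ v → ⟦ esymZero? n m v ⟧)

    heads : ∀ (u : List Carrier) (v : List (Fin n → Carrier)) → length u ≡ length v →
            map (λ g → g Fin.zero) (zipWith Vector._∷_ u v) ≡ u
    heads []      []      _  = refl
    heads (x ∷ u) (y ∷ v) eq = cong (x ∷_) (heads u v (ℕ.suc-injective eq))

    tails : ∀ (u : List Carrier) (v : List (Fin n → Carrier)) → length u ≡ length v → ∀ i →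
            map (λ g → g (Fin.suc i)) (zipWith Vector._∷_ u v) ≡ map (λ g → g i) v
    tails []      []      _  i = refl
    tails (x ∷ u) (y ∷ v) eq i = cong (y i ∷_) (tails u v (ℕ.suc-injective eq) i)

    separate : ∀ u v → length u ≡ length v → ⟦ esymZero? (suc n) m (zipWith Vector._∷_ u v) ⟧ ≤
               ⟦ esym commutativeRing m u ≈? 0# ⟧ ℕ.* ⟦ esymZero? n m v ⟧
    separate u v eq = ⟦⟧-× (esymZero? (suc n) m w) (esym commutativeRing m u ≈? 0#) (esymZero? n m v)
      (λ z → subst (_≈ 0#) (≡.trans (esym-coordinate commutativeRing m w Fin.zero)
                              (cong (esym commutativeRing m) (heads u v eq))) (z Fin.zero))
      (λ z i → subst (_≈ 0#) (≡.trans (esym-coordinate commutativeRing m w (Fin.suc i))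
                                (≡.trans (cong (esym commutativeRing m) (tails u v eq i))
                                         (≡.sym (esym-coordinate commutativeRing m v i)))) (z (Fin.suc i)))
      where w = zipWith Vector._∷_ u v

^-distribʳ-* : ∀ m n k → (m ℕ.* n) ^ k ≡ m ^ k ℕ.* n ^ k
^-distribʳ-* m n zero    = refl
^-distribʳ-* m n (suc k) =
  ≡.trans (cong (m ℕ.* n ℕ.*_) (^-distribʳ-* m n k)) (interchange m n (m ^ k) (n ^ k))
  where
  interchange : ∀ a b c d → a ℕ.* b ℕ.* (c ℕ.* d) ≡ a ℕ.* c ℕ.* (b ℕ.* d)
  interchange = solve-∀

module _ {q c ℓ₁ ℓ₂} .{{_ : NonZero q}} (F : FiniteField q c ℓ₁ ℓ₂) where
  open import Data.Nat.Base using (_+_; _*_; _∸_)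
  open import Data.Nat.Properties using (*-cancelʳ-≤)
  open FiniteField F using (commutativeRing)
  open FiniteFieldZeros F

  ZeroFree : (n m t : ℕ) → List (Fin n → CommutativeRing.Carrier commutativeRing) → Set _
  ZeroFree n m t S = ∀ S′ → S′ ⊆ S → length S′ ≡ t → ¬ EsymZero n m S′

  zeroFree⇒¬ForcesZero : ∀ {n m t k S} → ZeroFree n m t S → k ≤ length S →
                         ¬ ForcesZero (commutativeRing ^ᴿ n) t m k
  zeroFree⇒¬ForcesZero {S = S} free k≤∣S∣ forces =
    let S′ , S′⊆S , ∣S′∣≡t , S′≈0 = forces S k≤∣S∣ in free S′ S′⊆S ∣S′∣≡t S′≈0

  #esymZero-tuples≤′ : ∀ n m j → m ≤ suc j →
    ∑ (words (suc j) (tuples n)) (λ w → ⟦ esymZero? n m w ⟧) ≤ m ^ n * (q ^ n) ^ j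
  #esymZero-tuples≤′ n m j m≤t = begin
    ∑ (words (suc j) (tuples n)) (λ w → ⟦ esymZero? n m w ⟧)
      ≤⟨ #esymZero-tuples≤ n m (suc j) ⟩
    #esymZeros m (suc j) ^ n
      ≤⟨ ℕ.^-monoˡ-≤ n (*-cancelʳ-≤ _ _ q (≤-trans (#esymZeros≤ m (suc j) m≤t) (≤-reflexive (eq m q (q ^ j))))) ⟩
    (m * q ^ j) ^ n
      ≡⟨ ^-distribʳ-* m (q ^ j) n ⟩
    m ^ n * (q ^ j) ^ n
      ≡⟨ cong (m ^ n *_) (≡.trans (ℕ.^-*-assoc q j n) (≡.trans (cong (q ^_) (ℕ.*-comm j n)) (≡.sym (ℕ.^-*-assoc q n j)))) ⟩
    m ^ n * (q ^ n) ^ j ∎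
    where
    open ℕ.≤-Reasoning
    eq : ∀ m q p → m * (q * p) ≡ m * p * q
    eq = solve-∀

  zeroFree-exists : ∀ n m j r → m ≤ suc j →
    (∀ K → scaledExpSum K * (column j r (suc j) * m ^ n) ≤ K ! * q ^ n) →
    ∃ λ S → length S ≡ suc j + r × ZeroFree n m (suc j) S
  zeroFree-exists n m j r m≤t e≤ =
    let S , ∣S∣≡l , avoids = words-positive l (tuples n) (λ w → ⟦ avoids? w ⟧) avoiding>0
    in  S , ∣S∣≡l , λ S′ S′⊆S ∣S′∣≡t S′≈0 →
        All.lookup (⟦⟧-positive (avoids? S) avoids)
          (subst (λ k → S′ ∈ combinations k S) ∣S′∣≡t (⊆⇒∈-combinations S′⊆S)) S′≈0
    where
    open Avoiding (tuples n) (esymZero? n m) j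
    l = suc j + r
    d = column j r j + ((j + r) C j ∸ 1)
    column≡1+d : column j r (suc j) ≡ suc d
    column≡1+d = ≡.trans (cong (λ x → column j r j + x) (≡.sym (ℕ.m+[n∸m]≡n (C-positive j r)))) (ℕ.+-suc _ _)
    column≤ : ∀ s → s + suc j ≤ l → column j s (suc j) ≤ suc d
    column≤ s s+t≤l = ≤-trans (column-mono j (suc j) (ℕ.≤⇒≤′ (ℕ.+-cancelʳ-≤ (suc j) s r
      (≤-trans s+t≤l (≤-reflexive (ℕ.+-comm (suc j) r)))))) (≤-reflexive column≡1+d)
    small : m ^ n * suc (suc d) ^ suc d ≤ q ^ n * suc d ^ d
    small = e≤⇒small d (m ^ n) (q ^ n)
      (subst (λ D → scaledExpSum (suc d) * (D * m ^ n) ≤ suc d ! * q ^ n) column≡1+d (e≤ (suc d)))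
    step : ∀ k → q ^ n * #avoiding k ≤ #avoiding (suc k) + (k C j) * (#zeros * #avoiding (k ∸ j))
    step k = subst (λ Q → Q * #avoiding k ≤ #avoiding (suc k) + (k C j) * (#zeros * #avoiding (k ∸ j)))
      (length-tuples n) (#avoiding-step k)
    avoiding>0 : 0 < #avoiding l
    avoiding>0 = Growth.positive #avoiding (q ^ n) #zeros (m ^ n) j l d
      step (#esymZero-tuples≤′ n m j m≤t) column≤ small {{ℕ.m^n≢0 q n}} refl

C-differences : ∀ j r →
  (+ ((suc j ℕ.+ r) C suc j) ℤ.- + (r C suc j)) / 1 ≡ ι (column j r (suc j))
C-differences j r = cong (_/ 1) (begin
  + ((suc j ℕ.+ r) C suc j) ℤ.- + x        ≡⟨ cong (λ y → + y ℤ.- + x) (column-C j r (suc j)) ⟨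
  + D ℤ.+ + x ℤ.- + x                      ≡⟨ ℤ.+-assoc (+ D) (+ x) (ℤ.- + x) ⟩
  + D ℤ.+ (+ x ℤ.- + x)                    ≡⟨ cong (λ y → + D ℤ.+ y) (ℤ.+-inverseʳ (+ x)) ⟩
  + D ℤ.+ + 0                              ≡⟨ ℤ.+-identityʳ (+ D) ⟩
  + D                                      ∎)
  where
  open ≡.≡-Reasoning
  D = column j r (suc j)
  x = r C suc j

theorem2p4 : ∀ {c ℓ₁ ℓ₂} (q : ℕ) .{{_ : NonZero q}} → IsPrimePower q →
    (F : FiniteField q c ℓ₁ ℓ₂) →
    ∀ (n t m : ℕ) → 1 ℕ.≤ n → 1 ℕ.≤ t → 1 ℕ.≤ m → m ℕ.≤ t →
    ∀ (l : ℕ) → 1 ℕ.≤ l →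
    e ·ᵣ (((+ (l C t) ℤ.- + ((l ℕ.∸ t) C t)) / 1) ℚ.* (+ m / q) ^ℚ n) ≤ᵣ fromℚ 1ℚ →
    ∀ v → IsEGZ (FiniteField.commutativeRing F ^ᴿ n) t m v → [ l ] <∞ v
theorem2p4 q _ F n t@(suc j) m _ _ _ m≤t l _ er≤1 = λ where
    ⊤⁺    _                → SupStrict.[ l ]<⊤⁺
    [ k ] (_ , forces , _) → SupStrict.[ ℕ.≰⇒> (λ k≤l →
      let S , ∣S∣≡l , free = zeroFreeOfLength-l
      in  zeroFree⇒¬ForcesZero F {m = m} free (subst (k ≤_) (≡.sym ∣S∣≡l) k≤l) forces) ]
  where
  zeroFreeOfLength-l : ∃ λ S → length S ≡ l × ZeroFree F n m t S
  zeroFreeOfLength-l with t ℕ.≤? l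
  ... | no  t≰l = replicate l 0ᴿ , length-replicate l , λ S′ S′⊆S ∣S′∣≡t _ →
    t≰l (subst₂ _≤_ ∣S′∣≡t (length-replicate l) (length-mono-≤ S′⊆S))
    where 0ᴿ = CommutativeRing.0# (FiniteField.commutativeRing F ^ᴿ n)
  ... | yes t≤l = subst (λ l → ∃ λ S → length S ≡ l × ZeroFree F n m t S) t+r≡l
    (zeroFree-exists F n m j r m≤t (clearDenominators (column j r t) m q n
      (subst (λ D → e ·ᵣ (D ℚ.* (+ m / q) ^ℚ n) ≤ᵣ fromℚ 1ℚ) D≡column er≤1)))
    where
    r = l ℕ.∸ t
    t+r≡l : t ℕ.+ r ≡ l
    t+r≡l = ℕ.m+[n∸m]≡n t≤l
    D≡column : (+ (l C t) ℤ.- + (r C t)) / 1 ≡ ι (column j r t)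
    D≡column = ≡.trans (cong (λ l → (+ (l C t) ℤ.- + (r C t)) / 1) (≡.sym t+r≡l)) (C-differences j r)
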